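{- Let $G$ be a finite group acting on a sandpile graph $\Gamma=(V,E,\mathrm{wt},s)$, and let $\mathcal{S}(\Gamma)^G$ be the set of symmetric recurrent configurations on $\Gamma$ and $\widetilde\Delta^G$ the symmetrized reduced Laplacian. Then the number of symmetric recurrent configurations is $$|\mathcal{S}(\Gamma)^G|=\det\widetilde\Delta^G.$$
   Context: Sandpile graph: $\Gamma=(V,E,\mathrm{wt},s)$ is a finite directed graph with edge-weight function $\mathrm{wt}\colon V\times V\to\mathbb{N}=\{0,1,2,\dots\}$, $\mathrm{wt}(v,w)>0$ iff $(v,w)\in E$, and a vertex $s$ (the sink) such that every vertex has a directed path to $s$. Let $\widetilde V=V\setminus\{s\}$ and $\mathrm{outdeg}(v)=\sum_{w\in V}\mathrm{wt}(v,w)$. Configurations: a configuration is an element $c=\sum_{v\in\widetilde V}c_v v\in\mathbb{N}\widetilde V$. A vertex $v\in\widetilde V$ is unstable in $c$ if $c_v\ge\mathrm{outdeg}(v)$; firing it replaces $c$ by $c-\mathrm{outdeg}(v)v+\sum_{w\in\widetilde V}\mathrm{wt}(v,w)w$. Repeatedly firing unstable vertices leads in finitely many steps to a stable configuration (no unstable vertices) $c^\circ$, independent of the choices made. A configuration $c$ is recurrent if it is stable and for every configuration $a$ there is a configuration $b$ with $(a+b)^\circ=c$. Action: an action of $G$ on $\Gamma$ is an action of $G$ on the set $V$ with $gs=s$ for all $g\in G$ and such that $(v,w)\in E$ implies $(gv,gw)\in E$ with both edges having the same weight. It extends linearly to configurations. A configuration $c$ is symmetric if $gc=c$ for all $g\in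 G$. Symmetrized reduced Laplacian: the reduced Laplacian is $\widetilde\Delta\colon\mathbb{Z}\widetilde V\to\mathbb{Z}\widetilde V$, $\widetilde\Delta(v)=\mathrm{outdeg}(v)v-\sum_{w\in\widetilde V}\mathrm{wt}(v,w)w$. Let $\mathcal{O}=\{Gv:v\in\widetilde V\}$ be the set of orbits of non-sink vertices. Then $\widetilde\Delta^G\colon\mathbb{Z}\mathcal{O}\to\mathbb{Z}\mathcal{O}$ is the $\mathbb{Z}$-linear map such that for all $v,w\in\widetilde V$ the $Gw$-th component of $\widetilde\Delta^G(Gv)$ is the $w$-th component of $\sum_{u\in Gv}\widetilde\Delta(u)$ (independent of the choice of representative $w$). -}

module Defs where

open import Algebra.Bundles using (Group)
open import Data.Bool.Base using (if_then_else_)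
open import Data.Fin.Base using (Fin; zero; suc; toℕ; punchIn)
open import Data.Fin.Properties using (_≟_; any?)
open import Data.Integer.Base as ℤ using (ℤ; +_; 0ℤ; 1ℤ; -1ℤ)
import Data.Integer.Properties as ℤₚ
open import Data.List.Base using (List; allFin; deduplicate; length)
import Data.List.Base as List
open import Data.Nat.Base using (ℕ; zero; suc; _+_; _∸_; _≤_; _<_)
import Data.Nat.Properties as ℕₚ
open import Data.Product.Base using (_×_; _,_; proj₁; ∃-syntax)
open import Data.Vec.Base using (Vec; lookup; tabulate; zipWith)
open import Function.Bundles using (Inverse)
open import Level using (_⊔_; 0ℓ)
open import Relation.Binary.Bundles using (Setoid)
import Relation.Binary.Construct.On as On
open import Relation.Binary.Construct.Closure.ReflexiveTransitive using (Star)
open import Relation.Binary.PropositionalEquality using (_≡_; setoid; trans)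
open import Relation.Nullary.Decidable using (Dec; does; map′)

import Algebra.Properties.CommutativeMonoid.Sum as Sum
module ℕΣ = Sum ℕₚ.+-0-commutativeMonoid
module ℤΣ = Sum ℤₚ.+-0-commutativeMonoid

HasCardinality : ∀ {a ℓ} → Setoid a ℓ → ℕ → Set (a ⊔ ℓ)
HasCardinality S k = Inverse S (setoid (Fin k))

Matrix : ℕ → Set
Matrix k = Fin k → Fin k → ℤ

-- Cofactor expansion along the first row.
det : ∀ {k} → Matrix k → ℤ
det {zero}  A = 1ℤ
det {suc k} A = ℤΣ.sum λ j →
  (-1ℤ ℤ.^ toℕ j) ℤ.* A zero j ℤ.* det (λ i l → A (suc i) (punchIn j l))

-- The vertex set V is Fin (suc n); the edges are the pairs of positive weight.
record SandpileGraph (n : ℕ) : Set where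
  field
    wt   : Fin (suc n) → Fin (suc n) → ℕ
    sink : Fin (suc n)

  Edge : Fin (suc n) → Fin (suc n) → Set
  Edge v w = 0 < wt v w

  field
    pathToSink : ∀ v → Star Edge v sink

  outdeg : Fin (suc n) → ℕ
  outdeg v = ℕΣ.sum (wt v)

  -- Ṽ = V \ {sink} is indexed by Fin n; ι enumerates it inside V.
  ι : Fin n → Fin (suc n)
  ι = punchIn sink

module Sandpile {n : ℕ} (Γ : SandpileGraph n) where
  open SandpileGraph Γ

  Config : Set
  Config = Vec ℕ n

  _⊕_ : Config → Config → Config
  _⊕_ = zipWith _+_

  Unstable : Config → Fin n → Set
  Unstable c v = outdeg (ι v) ≤ lookup c v

  Stable : Config → Set
  Stable c = ∀ v → lookup c v < outdeg (ι v)

  -- Only ever applied to a vertex v that is unstable in c, so _∸_ does not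
  -- truncate.
  fire : Fin n → Config → Config
  fire v c = tabulate λ w →
    (lookup c w ∸ (if does (v ≟ w) then outdeg (ι v) else 0)) + wt (ι v) (ι w)

  _⟶_ : Config → Config → Set
  c ⟶ d = ∃[ v ] Unstable c v × d ≡ fire v c

  -- c ° d says that d is the stabilization c° of c.
  _°_ : Config → Config → Set
  c ° d = Star _⟶_ c d × Stable d

  Recurrent : Config → Set
  Recurrent c = Stable c × (∀ a → ∃[ b ] (a ⊕ b) ° c)

  -- Δ̃ v w is the w-component of Δ̃(v).
  Δ̃ : Fin n → Fin n → ℤ
  Δ̃ v w = (if does (v ≟ w) then + outdeg (ι v) else 0ℤ) ℤ.- + wt (ι v) (ι w)

record Action {c ℓ n} (G : Group c ℓ) (Γ : SandpileGraph n) : Set (c ⊔ ℓ) where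
  open Group G
  open SandpileGraph Γ
  infixr 7 _·_
  field
    _·_      : Carrier → Fin (suc n) → Fin (suc n)
    ·-cong   : ∀ {g h} → g ≈ h → ∀ v → g · v ≡ h · v
    ·-ε      : ∀ v → ε · v ≡ v
    ·-∙      : ∀ g h v → (g ∙ h) · v ≡ g · h · v
    ·-sink   : ∀ g → g · sink ≡ sink
    ·-edge   : ∀ g {v w} → Edge v w →
               Edge (g · v) (g · w) × wt (g · v) (g · w) ≡ wt v w

module Symmetric {c ℓ n k} {G : Group c ℓ} (finite : HasCardinality (Group.setoid G) k)
                 {Γ : SandpileGraph n} (A : Action G Γ) where
  open Group G using (Carrier)
  open SandpileGraph Γ
  open Sandpile Γ
  open Action A

  -- The linear extension g(∑ cᵥ v) = ∑ cᵥ (gv): its w-component collects the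
  -- cᵥ with gv = w.
  act : Carrier → Config → Config
  act g x = tabulate λ w →
    ℕΣ.sum λ v → if does (g · ι v ≟ ι w) then lookup x v else 0

  IsSymmetric : Config → Set c
  IsSymmetric x = ∀ g → act g x ≡ x

  -- Recurrent need not be proof-irrelevant, so elements are compared as
  -- configurations only.
  SymmetricRecurrent : Setoid c 0ℓ
  SymmetricRecurrent =
    On.setoid (setoid Config) (proj₁ {B = λ x → Recurrent x × IsSymmetric x})

  _∈Orbit_ : Fin n → Fin n → Set c
  u ∈Orbit v = ∃[ g ] g · ι v ≡ ι u

  _∈Orbit?_ : ∀ u v → Dec (u ∈Orbit v)
  u ∈Orbit? v = map′
    (λ (i , eq) → Inverse.from finite i , eq)
    (λ (g , eq) → Inverse.to finite g ,
      trans (·-cong (Inverse.strictlyInverseʳ finite g) (ι v)) eq)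
    (any? λ i → Inverse.from finite i · ι v ≟ ι u)

  -- The orbit set 𝒪, each orbit being listed once, by its first vertex.
  orbits : List (Fin n)
  orbits = deduplicate _∈Orbit?_ (allFin n)

  ∣𝒪∣ : ℕ
  ∣𝒪∣ = length orbits

  rep : Fin ∣𝒪∣ → Fin n
  rep = List.lookup orbits

  -- Matrix of the linear map Δ̃ᴳ in the basis 𝒪: the entry (i , j) is the
  -- G(rep i)-component of Δ̃ᴳ(G(rep j)).
  Δ̃ᴳ : Matrix ∣𝒪∣
  Δ̃ᴳ i j = ℤΣ.sum λ u → if does (u ∈Orbit? rep j) then Δ̃ u (rep i) else 0ℤ

module Submission where

-- Symmetric integer vectors are vectors on the orbits, and firing all vertices of an orbit
-- subtracts a column of Δ̃ᴳ. Every class of the cokernel of Δ̃ᴳ contains exactly one symmetric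
-- recurrent configuration: e = 2δ − (2δ)°, with δ = outdeg, is a positive symmetric element of
-- the image of Δ̃ᴳ which recurrent configurations absorb, so a representative is found by adding
-- a large multiple of e and stabilizing orbit by orbit, and two equivalent recurrent
-- configurations agree because, after adding a large multiple of e, both can be fired legally
-- to a common configuration.
-- The cokernel of an integer matrix A has ∣ det A ∣ elements, as column operations make the
-- first row zero beyond its first entry. Finally det Δ̃ᴳ > 0, since Δ̃ᴳ has nonpositive
-- off-diagonal entries and maps a nonnegative vector to the positive vector e.

open import Defs
open import Algebra.Bundles using (CommutativeMonoid; Group)
import Algebra.Properties.CommutativeMonoid.Sum as CommutativeMonoidSum
open import Algebra.Properties.CommutativeSemigroup using (xy∙z≈xz∙y)
import Algebra.Properties.Semiring.Sum as SemiringSum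
open import Data.Bool.Base using (Bool; true; false; _∨_; if_then_else_)
import Data.Bool.Properties as Boolₚ
open import Data.Fin.Base using (Fin; zero; suc; toℕ; inject₁; punchIn; punchOut; fromℕ<)
open import Data.Fin.Induction using (<-weakInduction)
open import Data.Fin.Permutation using (permutation)
open import Data.Fin.Properties using (_≟_; any?; *↔×; punchInᵢ≢i; punchIn-injective; punchIn-punchOut;
  suc-injective; toℕ-injective; toℕ-fromℕ<; toℕ<n)
open import Data.Integer.Base as ℤ using (ℤ; +_; 0ℤ; 1ℤ; -1ℤ; _+_; _*_; -_; ∣_∣)
import Data.Integer.DivMod as ℤ÷
import Data.Integer.Properties as ℤₚ
open import Data.Integer.Tactic.RingSolver using (solve-∀)
open import Data.List.Base as List using (List; []; _∷_; allFin)
open import Data.List.Membership.Propositional using (lose)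
open import Data.List.Membership.Propositional.Properties using (∈-allFin; ∈-lookup)
open import Data.List.Relation.Unary.All as All using (All; []; _∷_)
open import Data.List.Relation.Unary.AllPairs using (AllPairs; []; _∷_)
open import Data.List.Relation.Unary.Any as Any using (Any)
import Data.List.Relation.Unary.Any.Properties as Anyₚ
open import Data.List.Relation.Unary.Unique.DecSetoid.Properties using (deduplicate-!)
open import Data.Nat.Base as ℕ using (ℕ; zero; suc)
open import Data.Nat.Induction using (<-wellFounded)
import Data.Nat.Properties as ℕₚ
import Data.Nat.Tactic.RingSolver as ℕ-Solver
open import Data.Product.Base using (_×_; _,_; proj₁; proj₂; ∃-syntax)
open import Data.Sum.Base using (_⊎_; inj₁; inj₂)
open import Data.Vec.Base using (Vec; lookup; tabulate)
open import Data.Vec.Properties using (lookup∘tabulate; tabulate∘lookup; tabulate-cong; lookup-zipWith)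
open import Function.Base using (_∘_)
open import Function.Bundles using (Inverse)
open import Function.Consequences.Setoid using (strictlyInverseˡ⇒inverseˡ; strictlyInverseʳ⇒inverseʳ)
import Function.Construct.Composition as Compose
open import Function.Properties.Inverse using (↔-sym)
open import Induction.WellFounded using (Acc; acc)
open import Level using (Level; 0ℓ)
open import Relation.Binary.Bundles using (Setoid; DecSetoid)
open import Relation.Binary.Construct.Closure.ReflexiveTransitive using (Star; ε; _◅_; _◅◅_; gmap)
open import Relation.Binary.PropositionalEquality using (_≡_; _≢_; _≗_; refl; sym; trans; cong; cong₂; subst; setoid; module ≡-Reasoning)
open import Relation.Nullary using (Dec; yes; no; does; contradiction; ¬_; _×-dec_)
open import Relation.Nullary.Decidable using (dec-true; dec-false)

-- What singles out δ: a recurrent configuration is reached from some δ + b, by its definition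
-- applied to a = δ. Conversely, every stable configuration reached from some δ + ζ is recurrent,
-- because a large multiple of the positive e dominates any prescribed a and can be fired away
-- again. Absorption itself is a regrouping: δ + ζ + e = 2δ + (ζ + δ - (2δ)°), and firing 2δ down to
-- (2δ)° leaves δ + ζ. Symmetry enters through existence: in a symmetric configuration an unstable
-- vertex makes its whole orbit unstable, so stabilization follows a script that is constant on
-- orbits and changes the configuration by an element of the image of Δ̃ᴳ. For uniqueness, the orbit
-- coefficients are lifted to all vertices, where the legal firing orders are free to ignore the
-- action. The firing counts from 2δ to (2δ)° are used twice: they exhibit e in the image of Δ̃ᴳ,
-- and they are the nonnegative vector of the sign argument.

module ℕΣ* = SemiringSum ℕₚ.+-*-semiring
module ℤΣ* = SemiringSum ℤₚ.+-*-semiring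

-- Determinants

sum-zero : ∀ {k} {f : Fin k → ℤ} → (∀ i → f i ≡ 0ℤ) → ℤΣ.sum f ≡ 0ℤ
sum-zero {k} f≡0 = trans (ℤΣ.sum-cong-≗ f≡0) (ℤΣ.sum-replicate-zero k)

minor : ∀ {k} → Matrix (suc k) → Fin (suc k) → Matrix k
minor A j i l = A (suc i) (punchIn j l)

laplace : ∀ {k} → Matrix (suc k) → Fin (suc k) → ℤ
laplace A j = (-1ℤ ℤ.^ toℕ j) * A zero j * det (minor A j)

det-cong : ∀ {k} {A B : Matrix k} → (∀ i j → A i j ≡ B i j) → det A ≡ det B
det-cong {zero}  A≡B = refl
det-cong {suc k} A≡B = ℤΣ.sum-cong-≗ λ j →
  cong₂ (λ a d → (-1ℤ ℤ.^ toℕ j) * a * d) (A≡B zero j) (det-cong λ i l → A≡B (suc i) (punchIn j l))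

-- Transpositions of neighbouring positions, built like `Fin` so that a cofactor expansion can
-- recurse on them.
data AdjacentSwap : ℕ → Set where
  here  : ∀ {k} → AdjacentSwap (suc (suc k))
  there : ∀ {k} → AdjacentSwap k → AdjacentSwap (suc k)

swap : ∀ {k} → AdjacentSwap k → Fin k → Fin k
swap here      zero          = suc zero
swap here      (suc zero)    = zero
swap here      (suc (suc j)) = suc (suc j)
swap (there p) zero          = zero
swap (there p) (suc j)       = suc (swap p j)

swap-involutive : ∀ {k} (p : AdjacentSwap k) j → swap p (swap p j) ≡ j
swap-involutive here      zero          = refl
swap-involutive here      (suc zero)    = refl
swap-involutive here      (suc (suc j)) = refl
swap-involutive (there p) zero          = refl
swap-involutive (there p) (suc j)       = cong suc (swap-involutive p j)

-- The two ways in which a Laplace term changes sign: if `j` takes part in the swap, the remaining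
-- columns are the same and the cofactor sign flips; otherwise the swap survives as `q` in the
-- minor, where induction applies.
swap-punchIn : ∀ {k} (p : AdjacentSwap (suc k)) (j : Fin (suc k)) →
  (-1ℤ ℤ.^ toℕ j ≡ - (-1ℤ ℤ.^ toℕ (swap p j)) × swap p ∘ punchIn j ≗ punchIn (swap p j)) ⊎
  (swap p j ≡ j × ∃[ q ] swap p ∘ punchIn j ≗ punchIn j ∘ swap q)
swap-punchIn here zero       = inj₁ (refl , λ { zero → refl ; (suc l) → refl })
swap-punchIn here (suc zero) = inj₁ (refl , λ { zero → refl ; (suc l) → refl })
swap-punchIn {suc (suc k)} here (suc (suc j)) =
  inj₂ (refl , here , λ { zero → refl ; (suc zero) → refl ; (suc (suc l)) → refl })
swap-punchIn (there p) zero = inj₂ (refl , p , λ l → refl)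
swap-punchIn {suc k} (there p) (suc j) with swap-punchIn p j
... | inj₁ (sign , eq) = inj₁
  ( trans (cong (-1ℤ *_) sign) (sym (ℤₚ.neg-distribʳ-* -1ℤ (-1ℤ ℤ.^ toℕ (swap p j))))
  , λ { zero → refl ; (suc l) → cong suc (eq l) })
... | inj₂ (fixed , q , eq) = inj₂
  (cong suc fixed , there q , λ { zero → refl ; (suc l) → cong suc (eq l) })

sum-neg : ∀ {k} (f : Fin k → ℤ) → ℤΣ.sum (λ j → - f j) ≡ - ℤΣ.sum f
sum-neg {zero}  f = refl
sum-neg {suc k} f = trans (cong (_+_ (- f zero)) (sum-neg (f ∘ suc)))
  (sym (ℤₚ.neg-distrib-+ (f zero) (ℤΣ.sum (f ∘ suc))))

det-swap : ∀ {k} (p : AdjacentSwap k) (A : Matrix k) → det (λ i j → A i (swap p j)) ≡ - det A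
det-swap {suc k} p A = begin
  ℤΣ.sum (laplace (λ i j → A i (swap p j)))  ≡⟨ ℤΣ.sum-cong-≗ term ⟩
  ℤΣ.sum (λ j → - laplace A (swap p j))      ≡⟨ sum-neg (laplace A ∘ swap p) ⟩
  - ℤΣ.sum (laplace A ∘ swap p)              ≡⟨ cong -_ (ℤΣ.sum-permute (laplace A) π) ⟨
  - det A                                    ∎
  where
  open ≡-Reasoning
  π = permutation (swap p) (swap p) (swap-involutive p) (swap-involutive p)
  term : ∀ j → laplace (λ i j → A i (swap p j)) j ≡ - laplace A (swap p j)
  term j with swap-punchIn p j
  ... | inj₁ (sign , eq) = trans
    (cong₂ (λ s d → s * A zero (swap p j) * d) sign (det-cong λ i l → cong (A (suc i)) (eq l)))
    (rearrange (-1ℤ ℤ.^ toℕ (swap p j)) (A zero (swap p j)) (det (minor A (swap p j))))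
    where
    rearrange : ∀ s a d → - s * a * d ≡ - (s * a * d)
    rearrange = solve-∀
  ... | inj₂ (fixed , q , eq) rewrite fixed = trans
    (cong ((-1ℤ ℤ.^ toℕ j) * A zero j *_)
      (trans (det-cong λ i l → cong (A (suc i)) (eq l)) (det-swap q (minor A j))))
    (rearrange (-1ℤ ℤ.^ toℕ j) (A zero j) (det (minor A j)))
    where
    rearrange : ∀ s a d → s * a * - d ≡ - (s * a * d)
    rearrange = solve-∀

-- Phrased by agreement away from column `c`, so that it applies to matrices however they are
-- presented. The Laplace term at `c` is linear through its entry, every other one through its
-- minor.
det-linear : ∀ {k} (c : Fin k) (a b : ℤ) (A B C : Matrix k) →
  (∀ i j → j ≢ c → A i j ≡ B i j) → (∀ i j → j ≢ c → A i j ≡ C i j) →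
  (∀ i → A i c ≡ a * B i c + b * C i c) → det A ≡ a * det B + b * det C
det-linear {suc k} c a b A B C A≡B A≡C A≡aB+bC = begin
  ℤΣ.sum (laplace A)                                       ≡⟨ ℤΣ.sum-cong-≗ term ⟩
  ℤΣ.sum (λ j → a * laplace B j + b * laplace C j)         ≡⟨ ℤΣ.∑-distrib-+ (λ j → a * laplace B j) (λ j → b * laplace C j) ⟩
  ℤΣ.sum (λ j → a * laplace B j) + ℤΣ.sum (λ j → b * laplace C j)
    ≡⟨ cong₂ _+_ (ℤΣ*.*-distribˡ-sum a (laplace B)) (ℤΣ*.*-distribˡ-sum b (laplace C)) ⟨
  a * det B + b * det C                                    ∎
  where
  open ≡-Reasoning
  term : ∀ j → laplace A j ≡ a * laplace B j + b * laplace C j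
  term j with j ≟ c
  ... | yes refl = begin
    s * A zero j * det (minor A j)
      ≡⟨ cong (λ x → s * x * det (minor A j)) (A≡aB+bC zero) ⟩
    s * (a * B zero j + b * C zero j) * det (minor A j)
      ≡⟨ rearrange s a b (B zero j) (C zero j) (det (minor A j)) ⟩
    a * (s * B zero j * det (minor A j)) + b * (s * C zero j * det (minor A j))
      ≡⟨ cong₂ (λ x y → a * (s * B zero j * x) + b * (s * C zero j * y))
           (det-cong λ i l → A≡B (suc i) (punchIn j l) (punchInᵢ≢i j l))
           (det-cong λ i l → A≡C (suc i) (punchIn j l) (punchInᵢ≢i j l)) ⟩
    a * laplace B j + b * laplace C j ∎
    where
    s = -1ℤ ℤ.^ toℕ j
    rearrange : ∀ s a b x y d → s * (a * x + b * y) * d ≡ a * (s * x * d) + b * (s * y * d)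
    rearrange = solve-∀
  ... | no j≢c = begin
    s * A zero j * det (minor A j)
      ≡⟨ cong (s * A zero j *_) (det-linear (punchOut j≢c) a b (minor A j) (minor B j) (minor C j)
           (λ i l l≢ → A≡B (suc i) (punchIn j l) (avoid l≢))
           (λ i l l≢ → A≡C (suc i) (punchIn j l) (avoid l≢))
           λ i → subst (λ l → A (suc i) l ≡ a * B (suc i) l + b * C (suc i) l)
                   (sym (punchIn-punchOut j≢c)) (A≡aB+bC (suc i))) ⟩
    s * A zero j * (a * det (minor B j) + b * det (minor C j))
      ≡⟨ rearrange s (A zero j) a b (det (minor B j)) (det (minor C j)) ⟩
    a * (s * A zero j * det (minor B j)) + b * (s * A zero j * det (minor C j))
      ≡⟨ cong₂ (λ x y → a * (s * x * det (minor B j)) + b * (s * y * det (minor C j)))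
           (A≡B zero j j≢c) (A≡C zero j j≢c) ⟩
    a * laplace B j + b * laplace C j ∎
    where
    s = -1ℤ ℤ.^ toℕ j
    avoid : ∀ {l} → l ≢ punchOut j≢c → punchIn j l ≢ c
    avoid l≢ eq = l≢ (punchIn-injective j _ _ (trans eq (sym (punchIn-punchOut j≢c))))
    rearrange : ∀ s x a b d e → s * x * (a * d + b * e) ≡ a * (s * x * d) + b * (s * x * e)
    rearrange = solve-∀

i≡-i⇒i≡0 : ∀ i → i ≡ - i → i ≡ 0ℤ
i≡-i⇒i≡0 (+ zero) _ = refl

adjacent : ∀ {k} → Fin k → AdjacentSwap (suc k)
adjacent zero    = here
adjacent (suc j) = there (adjacent j)

swap-adjacentˡ : ∀ {k} (j : Fin k) → swap (adjacent j) (inject₁ j) ≡ suc j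
swap-adjacentˡ zero    = refl
swap-adjacentˡ (suc j) = cong suc (swap-adjacentˡ j)

-- Adjacent swaps carry the second copy down to the neighbour of the first column, where one more
-- swap leaves the matrix unchanged and forces `det A ≡ - det A`. One copy is fixed at column zero
-- because all later column operations involve that column.
det-repeated : ∀ {k} (j : Fin k) (A : Matrix (suc k)) → (∀ i → A i zero ≡ A i (suc j)) → det A ≡ 0ℤ
det-repeated {suc k} = <-weakInduction (λ j → (A : Matrix (suc (suc k))) →
  (∀ i → A i zero ≡ A i (suc j)) → det A ≡ 0ℤ) base step
  where
  base : ∀ A → (∀ i → A i zero ≡ A i (suc zero)) → det A ≡ 0ℤ
  base A eq = i≡-i⇒i≡0 (det A) (trans (det-cong swapped) (det-swap here A))
    where
    swapped : ∀ i j → A i j ≡ A i (swap here j)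
    swapped i zero          = eq i
    swapped i (suc zero)    = sym (eq i)
    swapped i (suc (suc j)) = refl
  step : ∀ j → (∀ A → (∀ i → A i zero ≡ A i (suc (inject₁ j))) → det A ≡ 0ℤ) →
    ∀ A → (∀ i → A i zero ≡ A i (suc (suc j))) → det A ≡ 0ℤ
  step j ih A eq = begin
    det A          ≡⟨ ℤₚ.neg-involutive (det A) ⟨
    - (- det A)    ≡⟨ cong -_ (det-swap p A) ⟨
    - det A′       ≡⟨ cong -_ (ih A′ λ i → trans (eq i) (cong (λ l → A i (suc l)) (sym (swap-adjacentˡ j)))) ⟩
    0ℤ             ∎
    where
    open ≡-Reasoning
    p = there (adjacent j)
    A′ : Matrix (suc (suc k))
    A′ i l = A i (swap p l)

replaceColumn : ∀ {k} → Fin k → (Fin k → ℤ) → Matrix k → Matrix k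
replaceColumn c v A i j with j ≟ c
... | yes _ = v i
... | no  _ = A i j

replaceColumn-≡ : ∀ {k} (c : Fin k) v (A : Matrix k) i → replaceColumn c v A i c ≡ v i
replaceColumn-≡ c v A i with c ≟ c
... | yes _  = refl
... | no c≢c = contradiction refl c≢c

replaceColumn-≢ : ∀ {k} (c : Fin k) v (A : Matrix k) i {j} → j ≢ c → replaceColumn c v A i j ≡ A i j
replaceColumn-≢ c v A i {j} j≢c with j ≟ c
... | yes j≡c = contradiction j≡c j≢c
... | no _    = refl

-- The factor `a` is there for fraction-free elimination, which scales a column by the pivot;
-- `a = 1` is the ordinary column operation.
det-combineᵣ : ∀ {k} (j : Fin k) (a b : ℤ) (A B : Matrix (suc k)) →
  (∀ i l → l ≢ suc j → B i l ≡ A i l) → (∀ i → B i (suc j) ≡ a * A i (suc j) + b * A i zero) →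
  det B ≡ a * det A
det-combineᵣ {k} j a b A B same combined = begin
  det B                  ≡⟨ det-linear (suc j) a b B A C same
                              (λ i l l≢ → trans (same i l l≢) (sym (replaceColumn-≢ (suc j) _ A i l≢)))
                              (λ i → trans (combined i) (cong (λ x → a * A i (suc j) + b * x) (sym (replaceColumn-≡ (suc j) (λ i → A i zero) A i)))) ⟩
  a * det A + b * det C  ≡⟨ cong (λ x → a * det A + b * x) (det-repeated j C λ i → sym (replaceColumn-≡ (suc j) _ A i)) ⟩
  a * det A + b * 0ℤ     ≡⟨ cong (_+_ (a * det A)) (ℤₚ.*-zeroʳ b) ⟩
  a * det A + 0ℤ         ≡⟨ ℤₚ.+-identityʳ _ ⟩
  a * det A              ∎
  where
  open ≡-Reasoning
  C : Matrix (suc k)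
  C = replaceColumn (suc j) (λ i → A i zero) A

det-combineₗ : ∀ {k} (j : Fin k) (b : ℤ) (A B : Matrix (suc k)) →
  (∀ i l → B i (suc l) ≡ A i (suc l)) → (∀ i → B i zero ≡ A i zero + b * A i (suc j)) →
  det B ≡ det A
det-combineₗ {k} j b A B same combined = begin
  det B                   ≡⟨ det-linear zero 1ℤ b B A C
                              (λ { i zero z≢z → contradiction refl z≢z ; i (suc l) _ → same i l })
                              (λ { i zero z≢z → contradiction refl z≢z ; i (suc l) _ → same i l })
                              (λ i → trans (combined i) (cong (_+ b * A i (suc j)) (sym (ℤₚ.*-identityˡ (A i zero))))) ⟩
  1ℤ * det A + b * det C  ≡⟨ cong₂ _+_ (ℤₚ.*-identityˡ (det A)) (trans (cong (b *_) (det-repeated j C λ i → refl)) (ℤₚ.*-zeroʳ b)) ⟩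
  det A + 0ℤ              ≡⟨ ℤₚ.+-identityʳ _ ⟩
  det A                   ∎
  where
  open ≡-Reasoning
  C : Matrix (suc k)
  C i zero    = A i (suc j)
  C i (suc l) = A i (suc l)

det-firstRow : ∀ {k} (A : Matrix (suc k)) → (∀ j → A zero (suc j) ≡ 0ℤ) →
  det A ≡ A zero zero * det (λ i j → A (suc i) (suc j))
det-firstRow A zeros = begin
  laplace A zero + ℤΣ.sum (laplace A ∘ suc)  ≡⟨ cong (_+_ (laplace A zero)) (sum-zero vanish) ⟩
  laplace A zero + 0ℤ                        ≡⟨ ℤₚ.+-identityʳ _ ⟩
  1ℤ * A zero zero * det (minor A zero)      ≡⟨ cong (_* det (minor A zero)) (ℤₚ.*-identityˡ (A zero zero)) ⟩
  A zero zero * det (minor A zero)           ∎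
  where
  open ≡-Reasoning
  vanish : ∀ j → laplace A (suc j) ≡ 0ℤ
  vanish j = cong (_* det (minor A (suc j)))
    (trans (cong ((-1ℤ ℤ.^ toℕ (suc j)) *_) (zeros j)) (ℤₚ.*-zeroʳ (-1ℤ ℤ.^ toℕ (suc j))))

-- Positivity of the determinant of an M-matrix

*-nonneg : ∀ {i j} → 0ℤ ℤ.≤ i → 0ℤ ℤ.≤ j → 0ℤ ℤ.≤ i * j
*-nonneg {+ a} {+ b} _ _ = subst (0ℤ ℤ.≤_) (ℤₚ.pos-* a b) (ℤ.+≤+ ℕ.z≤n)

*-nonpos-nonneg : ∀ {i j} → i ℤ.≤ 0ℤ → 0ℤ ℤ.≤ j → i * j ℤ.≤ 0ℤ
*-nonpos-nonneg {i} {+ b} i≤0 _ = ℤₚ.*-monoʳ-≤-nonNeg (+ b) i≤0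

*-pos : ∀ {i j} → 0ℤ ℤ.< i → 0ℤ ℤ.< j → 0ℤ ℤ.< i * j
*-pos {i} {j} 0<i 0<j = ℤₚ.*-monoʳ-<-pos j {{ℤ.positive 0<j}} 0<i

*-nonpos-nonpos : ∀ {i j} → i ℤ.≤ 0ℤ → j ℤ.≤ 0ℤ → 0ℤ ℤ.≤ i * j
*-nonpos-nonpos {i} {j} i≤0 j≤0 = subst (0ℤ ℤ.≤_) (rearrange i j)
  (*-nonneg (ℤₚ.neg-mono-≤ i≤0) (ℤₚ.neg-mono-≤ j≤0))
  where
  rearrange : ∀ i j → - i * - j ≡ i * j
  rearrange = solve-∀

pos*⇒pos : ∀ {i j} → 0ℤ ℤ.≤ j → 0ℤ ℤ.< i * j → 0ℤ ℤ.< i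
pos*⇒pos 0≤j 0<ij = ℤₚ.≰⇒> λ i≤0 → ℤₚ.<⇒≱ 0<ij (*-nonpos-nonneg i≤0 0≤j)

sum-nonpos : ∀ {k} {f : Fin k → ℤ} → (∀ i → f i ℤ.≤ 0ℤ) → ℤΣ.sum f ℤ.≤ 0ℤ
sum-nonpos {zero}  f≤0 = ℤₚ.≤-refl
sum-nonpos {suc k} f≤0 = ℤₚ.+-mono-≤ (f≤0 zero) (sum-nonpos (f≤0 ∘ suc))

infixl 7 _*ᵥ_
_*ᵥ_ : ∀ {k m} → (Fin k → Fin m → ℤ) → (Fin m → ℤ) → Fin k → ℤ
(A *ᵥ z) i = ℤΣ.sum λ j → A i j * z j

-- The Schur complement multiplied by the pivot, which keeps the elimination over ℤ.
schur : ∀ {k} → Matrix (suc k) → Matrix k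
schur A i j = A zero zero * A (suc i) (suc j) + (- A zero (suc j)) * A (suc i) zero

module _ {k : ℕ} (A : Matrix (suc k)) where

  -- At stage `t` columns 1 to `t` have been combined with the pivot column, so that each stage
  -- changes a single column and multiplies the determinant by the pivot.
  eliminate : ℕ → Matrix (suc k)
  eliminate t i zero = A i zero
  eliminate t i (suc j) with toℕ j ℕₚ.<? t
  ... | yes _ = A zero zero * A i (suc j) + (- A zero (suc j)) * A i zero
  ... | no  _ = A i (suc j)

  eliminate-< : ∀ t i {j} → toℕ j ℕ.< t →
    eliminate t i (suc j) ≡ A zero zero * A i (suc j) + (- A zero (suc j)) * A i zero
  eliminate-< t i {j} j<t with toℕ j ℕₚ.<? t
  ... | yes _  = refl
  ... | no j≮t = contradiction j<t j≮t

  eliminate-≮ : ∀ t i {j} → toℕ j ℕ.≮ t → eliminate t i (suc j) ≡ A i (suc j)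
  eliminate-≮ t i {j} j≮t with toℕ j ℕₚ.<? t
  ... | yes j<t = contradiction j<t j≮t
  ... | no _    = refl

  det-eliminate : ∀ t → t ℕ.≤ k → det (eliminate t) ≡ (A zero zero) ℤ.^ t * det A
  det-eliminate zero _ = trans (det-cong {A = eliminate zero} {B = A} λ { i zero → refl ; i (suc j) → refl }) (sym (ℤₚ.*-identityˡ (det A)))
  det-eliminate (suc t) t<k = begin
    det (eliminate (suc t))          ≡⟨ det-combineᵣ j (A zero zero) (- A zero (suc j)) (eliminate t) (eliminate (suc t)) same combined ⟩
    A zero zero * det (eliminate t)  ≡⟨ cong (A zero zero *_) (det-eliminate t (ℕₚ.<⇒≤ t<k)) ⟩
    A zero zero * ((A zero zero) ℤ.^ t * det A) ≡⟨ ℤₚ.*-assoc (A zero zero) _ (det A) ⟨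
    (A zero zero) ℤ.^ suc t * det A  ∎
    where
    open ≡-Reasoning
    j = fromℕ< t<k
    same : ∀ i l → l ≢ suc j → eliminate (suc t) i l ≡ eliminate t i l
    same i zero    _  = refl
    same i (suc l) l≢ with toℕ l ℕₚ.<? t
    ... | yes l<t = eliminate-< (suc t) i (ℕₚ.m<n⇒m<1+n l<t)
    ... | no l≮t  = eliminate-≮ (suc t) i λ l<1+t →
      l≢ (cong suc (toℕ-injective (trans (ℕₚ.≤-antisym (ℕ.s≤s⁻¹ l<1+t) (ℕₚ.≮⇒≥ l≮t)) (sym (toℕ-fromℕ< t<k)))))
    combined : ∀ i → eliminate (suc t) i (suc j) ≡ A zero zero * eliminate t i (suc j) + (- A zero (suc j)) * A i zero
    combined i = trans (eliminate-< (suc t) i (subst (ℕ._< suc t) (sym (toℕ-fromℕ< t<k)) ℕₚ.≤-refl))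
      (cong (λ x → A zero zero * x + (- A zero (suc j)) * A i zero)
        (sym (eliminate-≮ t i (λ j<t → ℕₚ.<-irrefl (toℕ-fromℕ< t<k) j<t))))

  -- Each of the `k` later columns costs one pivot factor, and the finished matrix has first row
  -- (pivot, 0, ..., 0). The pivots stay on both sides because only signs are compared afterwards.
  det-schur : (A zero zero) ℤ.^ k * det A ≡ A zero zero * det (schur A)
  det-schur = begin
    (A zero zero) ℤ.^ k * det A   ≡⟨ det-eliminate k ℕₚ.≤-refl ⟨
    det (eliminate k)             ≡⟨ det-firstRow (eliminate k) (λ j → trans (eliminate-< k zero (toℕ<n j)) (cancel (A zero zero) (A zero (suc j)))) ⟩
    A zero zero * det (λ i j → eliminate k (suc i) (suc j))
      ≡⟨ cong (A zero zero *_) (det-cong λ i j → eliminate-< k (suc i) (toℕ<n j)) ⟩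
    A zero zero * det (schur A)   ∎
    where
    open ≡-Reasoning
    cancel : ∀ a x → a * x + - x * a ≡ 0ℤ
    cancel = solve-∀

  -- The contributions of `z zero` cancel. What remains combines entries of `A *ᵥ z` with the
  -- coefficients `A zero zero` and `- A (suc i) zero`, both nonnegative for an M-matrix.
  schur-*ᵥ : ∀ z i → (schur A *ᵥ (z ∘ suc)) i ≡ A zero zero * (A *ᵥ z) (suc i) + (- A (suc i) zero) * (A *ᵥ z) zero
  schur-*ᵥ z i = begin
    ℤΣ.sum (λ j → schur A i j * z (suc j))
      ≡⟨ ℤΣ.sum-cong-≗ (λ j → split (A zero zero) (A (suc i) (suc j)) (A zero (suc j)) (A (suc i) zero) (z (suc j))) ⟩
    ℤΣ.sum (λ j → A zero zero * r j + (- A (suc i) zero) * r₀ j)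
      ≡⟨ ℤΣ.∑-distrib-+ (λ j → A zero zero * r j) (λ j → (- A (suc i) zero) * r₀ j) ⟩
    ℤΣ.sum (λ j → A zero zero * r j) + ℤΣ.sum (λ j → (- A (suc i) zero) * r₀ j)
      ≡⟨ cong₂ _+_ (ℤΣ*.*-distribˡ-sum (A zero zero) r) (ℤΣ*.*-distribˡ-sum (- A (suc i) zero) r₀) ⟨
    A zero zero * ℤΣ.sum r + (- A (suc i) zero) * ℤΣ.sum r₀
      ≡⟨ complete (A zero zero) (A (suc i) zero) (z zero) (ℤΣ.sum r) (ℤΣ.sum r₀) ⟩
    A zero zero * (A *ᵥ z) (suc i) + (- A (suc i) zero) * (A *ᵥ z) zero ∎
    where
    open ≡-Reasoning
    r r₀ : Fin k → ℤ
    r j = A (suc i) (suc j) * z (suc j)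
    r₀ j = A zero (suc j) * z (suc j)
    split : ∀ a b c d x → (a * b + - c * d) * x ≡ a * (b * x) + - d * (c * x)
    split = solve-∀
    complete : ∀ a d x s t → a * s + - d * t ≡ a * (d * x + s) + - d * (a * x + t)
    complete = solve-∀

^-pos : ∀ {i} → 0ℤ ℤ.< i → ∀ k → 0ℤ ℤ.< i ℤ.^ k
^-pos 0<i zero    = ℤ.+<+ ℕₚ.0<1+n
^-pos 0<i (suc k) = *-pos 0<i (^-pos 0<i k)

-- Schur complements inherit the certificate z of being a nonsingular M-matrix.
det-positive : ∀ {k} (A : Matrix k) (z : Fin k → ℤ) →
  (∀ {i j} → i ≢ j → A i j ℤ.≤ 0ℤ) → (∀ j → 0ℤ ℤ.≤ z j) → (∀ i → 0ℤ ℤ.< (A *ᵥ z) i) →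
  0ℤ ℤ.< det A
det-positive {zero}  A z off z≥0 Az>0 = ℤ.+<+ ℕₚ.0<1+n
det-positive {suc k} A z off z≥0 Az>0 = pos*⇒pos {det A} (ℤₚ.<⇒≤ (^-pos a>0 k))
  (subst (0ℤ ℤ.<_) (trans (sym (det-schur A)) (ℤₚ.*-comm ((A zero zero) ℤ.^ k) (det A)))
    (*-pos a>0 (det-positive (schur A) (z ∘ suc) off′ (z≥0 ∘ suc) positive)))
  where
  open ℤₚ.≤-Reasoning
  -- The off-diagonal terms in the first entry of `A *ᵥ z` are nonpositive, so the diagonal term
  -- alone must be positive.
  a>0 : 0ℤ ℤ.< A zero zero
  a>0 = pos*⇒pos (z≥0 zero) (begin-strict
    0ℤ                     <⟨ Az>0 zero ⟩
    (A *ᵥ z) zero          ≤⟨ ℤₚ.+-monoʳ-≤ (A zero zero * z zero) (sum-nonpos (λ j → *-nonpos-nonneg (off (λ ())) (z≥0 (suc j)))) ⟩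
    A zero zero * z zero + 0ℤ ≡⟨ ℤₚ.+-identityʳ _ ⟩
    A zero zero * z zero   ∎)
  off′ : ∀ {i j} → i ≢ j → schur A i j ℤ.≤ 0ℤ
  off′ {i} {j} i≢j = ℤₚ.+-mono-≤ {_} {0ℤ} {_} {0ℤ}
    (subst (ℤ._≤ 0ℤ) (ℤₚ.*-comm (A (suc i) (suc j)) (A zero zero)) (*-nonpos-nonneg (off (i≢j ∘ suc-injective)) (ℤₚ.<⇒≤ a>0)))
    (subst (ℤ._≤ 0ℤ) (ℤₚ.neg-distribˡ-* (A zero (suc j)) (A (suc i) zero)) (ℤₚ.neg-mono-≤ (*-nonpos-nonpos (off {zero} {suc j} (λ ())) (off {suc i} {zero} (λ ())))))
  positive : ∀ i → 0ℤ ℤ.< (schur A *ᵥ (z ∘ suc)) i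
  positive i = subst (0ℤ ℤ.<_) (sym (schur-*ᵥ A z i))
    (ℤₚ.+-mono-<-≤ (*-pos a>0 (Az>0 (suc i)))
      (*-nonneg (ℤₚ.neg-mono-≤ (off {suc i} {zero} (λ ()))) (ℤₚ.<⇒≤ (Az>0 zero))))

-- The cokernel of an integer matrix

mkInverse : ∀ {a b ℓ ℓ′} {S : Setoid a ℓ} {T : Setoid b ℓ′} →
  let open Setoid S using () renaming (_≈_ to _≈₁_; Carrier to A)
      open Setoid T using () renaming (_≈_ to _≈₂_; Carrier to B) in
  (f : A → B) (g : B → A) → (∀ {x y} → x ≈₁ y → f x ≈₂ f y) → (∀ {x y} → x ≈₂ y → g x ≈₁ g y) →
  (∀ y → f (g y) ≈₂ y) → (∀ x → g (f x) ≈₁ x) → Inverse S T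
mkInverse {S = S} {T} f g f-cong g-cong fg gf = record
  { to = f ; from = g ; to-cong = f-cong ; from-cong = g-cong
  ; inverse = strictlyInverseˡ⇒inverseˡ S T f-cong fg , strictlyInverseʳ⇒inverseʳ S T g-cong gf }

module _ {a ℓ : Level} (M : CommutativeMonoid a ℓ) where
  open CommutativeMonoid M renaming (refl to ≈-refl)
  open CommutativeMonoidSum M using (sum; sum-remove; sum-cong-≋)
  open import Relation.Binary.Reasoning.Setoid (CommutativeMonoid.setoid M)

  -- With `g` constantly neutral this also evaluates a sum in which a single term survives.
  sum-update : ∀ {k} (j : Fin k) {d} {f g : Fin k → Carrier} →
    (∀ l → l ≢ j → f l ≈ g l) → f j ≈ g j ∙ d → sum f ≈ sum g ∙ d
  sum-update {suc k} j {d} {f} {g} same new = begin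
    sum f                              ≈⟨ sum-remove f ⟩
    f j ∙ sum (f ∘ punchIn j)          ≈⟨ ∙-cong new (sum-cong-≋ λ l → same (punchIn j l) (punchInᵢ≢i j l)) ⟩
    (g j ∙ d) ∙ sum (g ∘ punchIn j)    ≈⟨ xy∙z≈xz∙y commutativeSemigroup (g j) d _ ⟩
    (g j ∙ sum (g ∘ punchIn j)) ∙ d    ≈⟨ ∙-congʳ (sum-remove g) ⟨
    sum g ∙ d                          ∎

-- Congruence modulo the column span

*ᵥ-cong : ∀ {k m} (A : Fin k → Fin m → ℤ) {y z} → (∀ j → y j ≡ z j) → ∀ i → (A *ᵥ y) i ≡ (A *ᵥ z) i
*ᵥ-cong A y≡z i = ℤΣ.sum-cong-≗ λ j → cong (A i j *_) (y≡z j)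

*ᵥ-linear : ∀ {k m} (A : Fin k → Fin m → ℤ) a b y z i →
  (A *ᵥ (λ j → a * y j + b * z j)) i ≡ a * (A *ᵥ y) i + b * (A *ᵥ z) i
*ᵥ-linear A a b y z i = begin
  ℤΣ.sum (λ j → A i j * (a * y j + b * z j))
    ≡⟨ ℤΣ.sum-cong-≗ (λ j → distribute (A i j) a b (y j) (z j)) ⟩
  ℤΣ.sum (λ j → a * (A i j * y j) + b * (A i j * z j))
    ≡⟨ ℤΣ.∑-distrib-+ (λ j → a * (A i j * y j)) (λ j → b * (A i j * z j)) ⟩
  ℤΣ.sum (λ j → a * (A i j * y j)) + ℤΣ.sum (λ j → b * (A i j * z j))
    ≡⟨ cong₂ _+_ (ℤΣ*.*-distribˡ-sum a (λ j → A i j * y j)) (ℤΣ*.*-distribˡ-sum b (λ j → A i j * z j)) ⟨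
  a * (A *ᵥ y) i + b * (A *ᵥ z) i ∎
  where
  open ≡-Reasoning
  distribute : ∀ x a b y z → x * (a * y + b * z) ≡ a * (x * y) + b * (x * z)
  distribute = solve-∀

*ᵥ-zero : ∀ {k m} (A : Fin k → Fin m → ℤ) i → (A *ᵥ (λ _ → 0ℤ)) i ≡ 0ℤ
*ᵥ-zero A i = sum-zero λ j → ℤₚ.*-zeroʳ (A i j)

record _≈_mod_ {k m} (x y : Fin k → ℤ) (A : Fin k → Fin m → ℤ) : Set where
  constructor _by_
  field
    coefficients : Fin m → ℤ
    difference   : ∀ i → x i ≡ y i + (A *ᵥ coefficients) i

module _ {k m : ℕ} {A : Fin k → Fin m → ℤ} where

  ≈-reflexive : ∀ {x y} → (∀ i → x i ≡ y i) → x ≈ y mod A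
  ≈-reflexive {x} {y} x≡y = (λ _ → 0ℤ) by λ i → trans (x≡y i)
    (sym (trans (cong (_+_ (y i)) (*ᵥ-zero A i)) (ℤₚ.+-identityʳ (y i))))

  ≈-sym : ∀ {x y} → x ≈ y mod A → y ≈ x mod A
  -- The negated coefficients are written as a combination with the zero vector, so that `*ᵥ-linear`
  -- applies as it stands.
  ≈-sym {x} {y} (z by eq) = (λ j → -1ℤ * z j + 0ℤ * 0ℤ) by λ i → begin
    y i                                              ≡⟨ cancel (y i) ((A *ᵥ z) i) ((A *ᵥ (λ _ → 0ℤ)) i) ⟩
    (y i + (A *ᵥ z) i) + (-1ℤ * (A *ᵥ z) i + 0ℤ * (A *ᵥ (λ _ → 0ℤ)) i)
      ≡⟨ cong₂ _+_ (eq i) (*ᵥ-linear A -1ℤ 0ℤ z (λ _ → 0ℤ) i) ⟨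
    x i + (A *ᵥ (λ j → -1ℤ * z j + 0ℤ * 0ℤ)) i       ∎
    where
    open ≡-Reasoning
    cancel : ∀ y s t → y ≡ (y + s) + (-1ℤ * s + 0ℤ * t)
    cancel = solve-∀

  ≈-trans : ∀ {x y w} → x ≈ y mod A → y ≈ w mod A → x ≈ w mod A
  ≈-trans {x} {y} {w} (z by eq) (z′ by eq′) = (λ j → 1ℤ * z j + 1ℤ * z′ j) by λ i → begin
    x i                                            ≡⟨ trans (eq i) (cong (_+ (A *ᵥ z) i) (eq′ i)) ⟩
    (w i + (A *ᵥ z′) i) + (A *ᵥ z) i               ≡⟨ rearrange (w i) ((A *ᵥ z′) i) ((A *ᵥ z) i) ⟩
    w i + (1ℤ * (A *ᵥ z) i + 1ℤ * (A *ᵥ z′) i)     ≡⟨ cong (_+_ (w i)) (*ᵥ-linear A 1ℤ 1ℤ z z′ i) ⟨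
    w i + (A *ᵥ (λ j → 1ℤ * z j + 1ℤ * z′ j)) i    ∎
    where
    open ≡-Reasoning
    rearrange : ∀ w s t → (w + s) + t ≡ w + (1ℤ * t + 1ℤ * s)
    rearrange = solve-∀

Cokernel : ∀ {k m} → (Fin k → Fin m → ℤ) → Setoid 0ℓ 0ℓ
Cokernel {k} A = record
  { Carrier = Fin k → ℤ
  ; _≈_ = λ x y → x ≈ y mod A
  ; isEquivalence = record { refl = ≈-reflexive {A = A} (λ _ → refl) ; sym = ≈-sym {A = A} ; trans = ≈-trans {A = A} } }

-- What reduction has to preserve: the column span determines the cokernel, and the determinant
-- gives the claimed count.
record ColumnEquivalent {k} (A B : Matrix k) : Set where
  field
    det-≡ : det A ≡ det B
    ⊆     : ∀ z → ∃[ w ] ∀ i → (A *ᵥ z) i ≡ (B *ᵥ w) i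
    ⊇     : ∀ z → ∃[ w ] ∀ i → (B *ᵥ z) i ≡ (A *ᵥ w) i
open ColumnEquivalent

ColumnEquivalent-refl : ∀ {k} {A : Matrix k} → ColumnEquivalent A A
ColumnEquivalent-refl = record { det-≡ = refl ; ⊆ = λ z → z , λ _ → refl ; ⊇ = λ z → z , λ _ → refl }

ColumnEquivalent-trans : ∀ {k} {A B C : Matrix k} →
  ColumnEquivalent A B → ColumnEquivalent B C → ColumnEquivalent A C
ColumnEquivalent-trans A~B B~C = record
  { det-≡ = trans (det-≡ A~B) (det-≡ B~C)
  ; ⊆ = λ z → let w , eq = ⊆ A~B z ; v , eq′ = ⊆ B~C w in v , λ i → trans (eq i) (eq′ i)
  ; ⊇ = λ z → let w , eq = ⊇ B~C z ; v , eq′ = ⊇ A~B w in v , λ i → trans (eq i) (eq′ i) }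

module _ {k : ℕ} (j : Fin k) where

  -- Relations instead of functions, so that undoing an operation is the same relation with `- q`
  -- and one inclusion of spans yields the other.
  CombinedRight CombinedLeft : ℤ → Matrix (suc k) → Matrix (suc k) → Set
  CombinedRight q A B = (∀ i l → l ≢ suc j → B i l ≡ A i l) × (∀ i → B i (suc j) ≡ A i (suc j) + q * A i zero)
  CombinedLeft q A B = (∀ i l → B i (suc l) ≡ A i (suc l)) × (∀ i → B i zero ≡ A i zero + q * A i (suc j))

  private
    undo : ∀ {a b} q c → b ≡ a + q * c → a ≡ b + - q * c
    undo {a} {b} q c eq = trans (cancel a q c) (cong (_+ - q * c) (sym eq))
      where
      cancel : ∀ a q c → a ≡ (a + q * c) + - q * c
      cancel = solve-∀

    right-⊇ : ∀ {q A B} → CombinedRight q A B → ∀ z → ∃[ w ] ∀ i → (B *ᵥ z) i ≡ (A *ᵥ w) i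
    right-⊇ {q} {A} {B} (same , new) z = w , λ i → begin
      B i zero * z zero + ℤΣ.sum (λ l → B i (suc l) * z (suc l))
        ≡⟨ cong₂ _+_ (cong (_* z zero) (same i zero λ ())) (sum-update ℤₚ.+-0-commutativeMonoid j
             (λ l l≢j → cong (_* z (suc l)) (same i (suc l) (l≢j ∘ suc-injective)))
             (trans (cong (_* z (suc j)) (new i)) (ℤₚ.*-distribʳ-+ (z (suc j)) (A i (suc j)) (q * A i zero)))) ⟩
      A i zero * z zero + (ℤΣ.sum (λ l → A i (suc l) * z (suc l)) + q * A i zero * z (suc j))
        ≡⟨ rearrange (A i zero) (z zero) (ℤΣ.sum (λ l → A i (suc l) * z (suc l))) q (z (suc j)) ⟩
      A i zero * (z zero + q * z (suc j)) + ℤΣ.sum (λ l → A i (suc l) * z (suc l)) ∎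
      where
      open ≡-Reasoning
      w : Fin (suc k) → ℤ
      w zero    = z zero + q * z (suc j)
      w (suc l) = z (suc l)
      rearrange : ∀ a x s q y → a * x + (s + q * a * y) ≡ a * (x + q * y) + s
      rearrange = solve-∀

    left-⊇ : ∀ {q A B} → CombinedLeft q A B → ∀ z → ∃[ w ] ∀ i → (B *ᵥ z) i ≡ (A *ᵥ w) i
    left-⊇ {q} {A} {B} (same , new) z = w , λ i → begin
      B i zero * z zero + ℤΣ.sum (λ l → B i (suc l) * z (suc l))
        ≡⟨ cong₂ _+_ (cong (_* z zero) (new i)) (ℤΣ.sum-cong-≗ λ l → cong (_* z (suc l)) (same i l)) ⟩
      (A i zero + q * A i (suc j)) * z zero + ℤΣ.sum (λ l → A i (suc l) * z (suc l))
        ≡⟨ rearrange (A i zero) q (A i (suc j)) (z zero) (ℤΣ.sum (λ l → A i (suc l) * z (suc l))) ⟩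
      A i zero * z zero + (ℤΣ.sum (λ l → A i (suc l) * z (suc l)) + A i (suc j) * (q * z zero))
        ≡⟨ cong (_+_ (A i zero * z zero)) (sum-update ℤₚ.+-0-commutativeMonoid j
             (λ l l≢j → cong (A i (suc l) *_) (replace-≢ l l≢j))
             (trans (cong (A i (suc j) *_) replace-≡) (ℤₚ.*-distribˡ-+ (A i (suc j)) (z (suc j)) (q * z zero)))) ⟨
      A i zero * z zero + ℤΣ.sum (λ l → A i (suc l) * w (suc l)) ∎
      where
      open ≡-Reasoning
      w : Fin (suc k) → ℤ
      w zero = z zero
      w (suc l) with l ≟ j
      ... | yes _ = z (suc l) + q * z zero
      ... | no _  = z (suc l)
      replace-≡ : w (suc j) ≡ z (suc j) + q * z zero
      replace-≡ with j ≟ j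
      ... | yes _  = refl
      ... | no j≢j = contradiction refl j≢j
      replace-≢ : ∀ l → l ≢ j → w (suc l) ≡ z (suc l)
      replace-≢ l l≢j with l ≟ j
      ... | yes l≡j = contradiction l≡j l≢j
      ... | no _    = refl
      rearrange : ∀ a q b x s → (a + q * b) * x + s ≡ a * x + (s + b * (q * x))
      rearrange = solve-∀

  CombinedRight⇒ColumnEquivalent : ∀ {q A B} → CombinedRight q A B → ColumnEquivalent A B
  CombinedRight⇒ColumnEquivalent {q} {A} {B} c@(same , new) = record
    { det-≡ = sym (trans (det-combineᵣ j 1ℤ q A B same λ i → trans (new i) (cong (_+ q * A i zero) (sym (ℤₚ.*-identityˡ (A i (suc j))))))
                         (ℤₚ.*-identityˡ (det A)))
    ; ⊆ = right-⊇ { - q} {B} {A} ((λ i l l≢ → sym (same i l l≢)) ,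
            λ i → trans (undo q (A i zero) (new i)) (cong (λ x → B i (suc j) + - q * x) (sym (same i zero λ ()))))
    ; ⊇ = right-⊇ {q} {A} {B} c }

  CombinedLeft⇒ColumnEquivalent : ∀ {q A B} → CombinedLeft q A B → ColumnEquivalent A B
  CombinedLeft⇒ColumnEquivalent {q} {A} {B} c@(same , new) = record
    { det-≡ = sym (det-combineₗ j q A B same new)
    ; ⊆ = left-⊇ { - q} {B} {A} ((λ i l → sym (same i l)) ,
            λ i → trans (undo q (A i (suc j)) (new i)) (cong (λ x → B i zero + - q * x) (sym (same i j))))
    ; ⊇ = left-⊇ {q} {A} {B} c }

  addRight addLeft : ℤ → Matrix (suc k) → Matrix (suc k)
  addRight q A = replaceColumn (suc j) (λ i → A i (suc j) + q * A i zero) A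
  addLeft q A i zero    = A i zero + q * A i (suc j)
  addLeft q A i (suc l) = A i (suc l)

  addRight-combined : ∀ q A → CombinedRight q A (addRight q A)
  addRight-combined q A = (λ i l → replaceColumn-≢ (suc j) _ A i) , replaceColumn-≡ (suc j) _ A

  -- One Euclidean step turns the entries (r + q b , b) into (r + b , - r).
  clearColumn : (A : Matrix (suc k)) → Acc ℕ._<_ ∣ A zero (suc j) ∣ →
    ∃[ B ] ColumnEquivalent A B × B zero (suc j) ≡ 0ℤ × (∀ l → l ≢ j → B zero (suc l) ≡ A zero (suc l))
  clearColumn A (acc rs) with A zero (suc j) ℤₚ.≟ 0ℤ
  ... | yes b≡0 = A , ColumnEquivalent-refl , b≡0 , λ _ _ → refl
  ... | no b≢0 = B , ColumnEquivalent-trans A~A₁ (ColumnEquivalent-trans A₁~A₂ A₂~B) , zero-j ,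
      λ l l≢j → trans (same l l≢j) (proj₁ (addRight-combined -1ℤ A₁) zero (suc l) (l≢j ∘ suc-injective))
    where
    b = A zero (suc j)
    instance
      b-nonZero : ℤ.NonZero b
      b-nonZero = ℤ.≢-nonZero b≢0
    q = A zero zero ℤ÷./ b
    r = A zero zero ℤ÷.% b
    A₁ A₂ : Matrix (suc k)
    -- Leaving `r + b` instead of `r` lets the next subtraction put `- r` into the column: the two
    -- columns exchange roles without a swap, which would flip the determinant.
    A₁ = addLeft (1ℤ + - q) A
    A₂ = addRight -1ℤ A₁
    A~A₁ : ColumnEquivalent A A₁
    A~A₁ = CombinedLeft⇒ColumnEquivalent {1ℤ + - q} {A} {A₁} ((λ _ _ → refl) , λ _ → refl)
    A₁~A₂ : ColumnEquivalent A₁ A₂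
    A₁~A₂ = CombinedRight⇒ColumnEquivalent { -1ℤ} {A₁} {A₂} (addRight-combined -1ℤ A₁)
    entry : A₂ zero (suc j) ≡ - + r
    entry = begin
      A₂ zero (suc j)                                    ≡⟨ proj₂ (addRight-combined -1ℤ A₁) zero ⟩
      b + -1ℤ * (A zero zero + (1ℤ + - q) * b)           ≡⟨ cong (λ x → b + -1ℤ * (x + (1ℤ + - q) * b)) (ℤ÷.a≡a%n+[a/n]*n (A zero zero) b) ⟩
      b + -1ℤ * ((+ r + q * b) + (1ℤ + - q) * b)         ≡⟨ euclid b (+ r) q ⟩
      - + r                                              ∎
      where
      open ≡-Reasoning
      euclid : ∀ b r q → b + -1ℤ * ((r + q * b) + (1ℤ + - q) * b) ≡ - r
      euclid = solve-∀
    smaller : ∣ A₂ zero (suc j) ∣ ℕ.< ∣ b ∣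
    smaller = subst (ℕ._< ∣ b ∣) (sym (trans (cong ∣_∣ entry) (ℤₚ.∣-i∣≡∣i∣ (+ r)))) (ℤ÷.n%d<d (A zero zero) b)
    rec = clearColumn A₂ (rs smaller)
    B = proj₁ rec
    A₂~B = proj₁ (proj₂ rec)
    zero-j = proj₁ (proj₂ (proj₂ rec))
    same = proj₂ (proj₂ (proj₂ rec))

clearFirstRow : ∀ {k} (A : Matrix (suc k)) (js : List (Fin k)) →
  ∃[ B ] ColumnEquivalent A B × All (λ j → B zero (suc j) ≡ 0ℤ) js
clearFirstRow A [] = A , ColumnEquivalent-refl , []
clearFirstRow A (j ∷ js) =
  let B , A~B , zeros = clearFirstRow A js
      C , B~C , zero-j , same = clearColumn j B (<-wellFounded _)
      zeros′ : ∀ {l} → B zero (suc l) ≡ 0ℤ → C zero (suc l) ≡ 0ℤ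
      zeros′ {l} z = keep B C j zero-j same l z
  in C , ColumnEquivalent-trans A~B B~C , zero-j ∷ All.map zeros′ zeros
  where
  keep : ∀ (B C : Matrix _) j → C zero (suc j) ≡ 0ℤ → (∀ l → l ≢ j → C zero (suc l) ≡ B zero (suc l)) →
    ∀ l → B zero (suc l) ≡ 0ℤ → C zero (suc l) ≡ 0ℤ
  keep B C j zero-j same l z with l ≟ j
  ... | yes refl = zero-j
  ... | no l≢j   = trans (same l l≢j) z

-- The multiple `(q′ + - q) * d` equals a difference of two remainders, so its absolute value lies
-- below that of `d` and it vanishes.
remainder-unique : ∀ d {r r′ q q′} → r ℕ.< ∣ d ∣ → r′ ℕ.< ∣ d ∣ → + r + q * d ≡ + r′ + q′ * d → r ≡ r′ × q ≡ q′
remainder-unique d {r} {r′} {q} {q′} r<d r′<d eq = r≡r′ , q≡q′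
  where
  open ≡-Reasoning
  difference : (q′ + - q) * d ≡ + r + - + r′
  difference = begin
    (q′ + - q) * d                     ≡⟨ expand (+ r′) q q′ d ⟩
    (+ r′ + q′ * d) + - (+ r′ + q * d) ≡⟨ cong (_+ - (+ r′ + q * d)) eq ⟨
    (+ r + q * d) + - (+ r′ + q * d)   ≡⟨ collapse (+ r) (+ r′) (q * d) ⟩
    + r + - + r′                       ∎
    where
    expand : ∀ r q q′ d → (q′ + - q) * d ≡ (r + q′ * d) + - (r + q * d)
    expand = solve-∀
    collapse : ∀ r r′ s → (r + s) + - (r′ + s) ≡ r + - r′
    collapse = solve-∀
  small : ∣ q′ + - q ∣ ℕ.* ∣ d ∣ ℕ.< ∣ d ∣
  small = subst (ℕ._< ∣ d ∣) (trans (cong ∣_∣ (sym difference)) (ℤₚ.abs-* (q′ + - q) d))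
    (ℕₚ.≤-<-trans (subst (ℕ._≤ r ℕ.⊔ r′) (cong ∣_∣ (sym (ℤₚ.m-n≡m⊖n r r′))) (ℤₚ.∣m⊝n∣≤m⊔n r r′)) (ℕₚ.⊔-lub r<d r′<d))
  vanish : ∀ n → n ℕ.* ∣ d ∣ ℕ.< ∣ d ∣ → n ≡ 0
  vanish zero    _  = refl
  vanish (suc n) lt = contradiction (ℕₚ.m≤m+n ∣ d ∣ (n ℕ.* ∣ d ∣)) (ℕₚ.<⇒≱ lt)
  q′-q≡0 : q′ + - q ≡ 0ℤ
  q′-q≡0 = ℤₚ.∣i∣≡0⇒i≡0 (vanish _ small)
  q≡q′ : q ≡ q′
  q≡q′ = sym (ℤₚ.i-j≡0⇒i≡j q′ q q′-q≡0)
  r≡r′ : r ≡ r′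
  r≡r′ = ℤₚ.+-injective (ℤₚ.i-j≡0⇒i≡j (+ r) (+ r′) (trans (sym difference) (cong (_* d) q′-q≡0)))

module _ {k : ℕ} (A : Matrix (suc k)) (zeros : ∀ j → A zero (suc j) ≡ 0ℤ) {{d≢0 : ℤ.NonZero (A zero zero)}} {N : ℕ} where
  private
    d = A zero zero
    A′ : Matrix k
    A′ i j = A (suc i) (suc j)

    top : ∀ z → (A *ᵥ z) zero ≡ z zero * d
    top z = begin
      d * z zero + ℤΣ.sum (λ j → A zero (suc j) * z (suc j))  ≡⟨ cong (_+_ (d * z zero)) (sum-zero λ j → cong (_* z (suc j)) (zeros j)) ⟩
      d * z zero + 0ℤ                                         ≡⟨ ℤₚ.+-identityʳ _ ⟩
      d * z zero                                              ≡⟨ ℤₚ.*-comm d (z zero) ⟩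
      z zero * d                                              ∎
      where open ≡-Reasoning

  -- Subtracting `x zero / d` times the first column reduces the first coordinate to a residue. The
  -- freedom left is that of the other columns, which vanish in the first row, so the remaining
  -- coordinates matter exactly modulo `A′`.
  cokernel-firstRow : HasCardinality (Cokernel A′) N → HasCardinality (Cokernel A) (∣ d ∣ ℕ.* N)
  cokernel-firstRow coker′ = Compose.inverse {S = setoid (Fin ∣ d ∣ × Fin N)} split (↔-sym *↔×)
    where
    module C = Inverse coker′
    residue : ℤ → Fin ∣ d ∣
    residue x = fromℕ< (ℤ÷.n%d<d x d)
    residue-spec : ∀ x → x ≡ + toℕ (residue x) + (x ℤ÷./ d) * d
    residue-spec x = trans (ℤ÷.a≡a%n+[a/n]*n x d)
      (cong (λ r → + r + (x ℤ÷./ d) * d) (sym (toℕ-fromℕ< (ℤ÷.n%d<d x d))))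
    rest : (Fin (suc k) → ℤ) → Fin k → ℤ
    rest x i = x (suc i) + - (x zero ℤ÷./ d) * A (suc i) zero
    f : (Fin (suc k) → ℤ) → Fin ∣ d ∣ × Fin N
    f x = residue (x zero) , C.to (rest x)
    g : Fin ∣ d ∣ × Fin N → Fin (suc k) → ℤ
    g (a , b) zero    = + toℕ a
    g (a , b) (suc i) = C.from b i
    unique : ∀ {x a q} → x ≡ + toℕ a + q * d → residue x ≡ a × x ℤ÷./ d ≡ q
    unique {x} {a} eq =
      let r≡ , q≡ = remainder-unique d (toℕ<n (residue x)) (toℕ<n a) (trans (sym (residue-spec x)) eq)
      in toℕ-injective r≡ , q≡
    f-cong : ∀ {x y} → x ≈ y mod A → f x ≡ f y
    f-cong {x} {y} (z by eq) = cong₂ _,_ (proj₁ same) (C.to-cong ((λ j → z (suc j)) by λ i → begin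
      x (suc i) + - (x zero ℤ÷./ d) * A (suc i) zero
        ≡⟨ cong₂ (λ s q → s + - q * A (suc i) zero) (eq (suc i)) (proj₂ same) ⟩
      (y (suc i) + (A (suc i) zero * z zero + (A′ *ᵥ (z ∘ suc)) i)) + - (y zero ℤ÷./ d + z zero) * A (suc i) zero
        ≡⟨ rearrange (y (suc i)) (A (suc i) zero) (z zero) ((A′ *ᵥ (z ∘ suc)) i) (y zero ℤ÷./ d) ⟩
      y (suc i) + - (y zero ℤ÷./ d) * A (suc i) zero + (A′ *ᵥ (z ∘ suc)) i ∎))
      where
      open ≡-Reasoning
      rearrange : ∀ y a z s q → (y + (a * z + s)) + - (q + z) * a ≡ y + - q * a + s
      rearrange = solve-∀
      factor : ∀ r q d z → (r + q * d) + z * d ≡ r + (q + z) * d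
      factor = solve-∀
      same : residue (x zero) ≡ residue (y zero) × x zero ℤ÷./ d ≡ y zero ℤ÷./ d + z zero
      same = unique (begin
        x zero                                     ≡⟨ eq zero ⟩
        y zero + (A *ᵥ z) zero                     ≡⟨ cong₂ _+_ (residue-spec (y zero)) (top z) ⟩
        (+ toℕ (residue (y zero)) + (y zero ℤ÷./ d) * d) + z zero * d
          ≡⟨ factor (+ toℕ (residue (y zero))) (y zero ℤ÷./ d) d (z zero) ⟩
        + toℕ (residue (y zero)) + (y zero ℤ÷./ d + z zero) * d ∎)
    fg : ∀ t → f (g t) ≡ t
    fg (a , b) = cong₂ _,_ (proj₁ same) (trans (C.to-cong (≈-reflexive {A = A′} λ i →
      trans (cong (λ q → C.from b i + - q * A (suc i) zero) (proj₂ same)) (ℤₚ.+-identityʳ (C.from b i)))) (C.strictlyInverseˡ b))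
      where
      same : residue (+ toℕ a) ≡ a × (+ toℕ a) ℤ÷./ d ≡ 0ℤ
      same = unique (sym (ℤₚ.+-identityʳ (+ toℕ a)))
    gf : ∀ x → g (f x) ≈ x mod A
    gf x with C.strictlyInverseʳ (rest x)
    ... | z by eq = w by λ
      { zero → trans (cancel (+ toℕ (residue (x zero))) q d)
          (cong₂ _+_ (sym (residue-spec (x zero))) (sym (top w)))
      ; (suc i) → trans (eq i) (rearrange (x (suc i)) q (A (suc i) zero) ((A′ *ᵥ z) i)) }
      where
      q = x zero ℤ÷./ d
      w : Fin (suc k) → ℤ
      w zero    = - q
      w (suc j) = z j
      cancel : ∀ r q d → r ≡ (r + q * d) + - q * d
      cancel = solve-∀
      rearrange : ∀ x q a s → (x + - q * a) + s ≡ x + (a * - q + s)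
      rearrange = solve-∀
    split : Inverse (Cokernel A) (setoid (Fin ∣ d ∣ × Fin N))
    split = mkInverse {S = Cokernel A} {T = setoid (Fin ∣ d ∣ × Fin N)} f g f-cong (λ { refl → ≈-reflexive {A = A} λ _ → refl }) fg gf

-- A nonzero determinant makes the corner entry nonzero after each reduction, so that every stage
-- contributes a finite nonempty set of residues.
cokernel-cardinality : ∀ {k} (A : Matrix k) → det A ≢ 0ℤ → HasCardinality (Cokernel A) ∣ det A ∣
-- Over the empty index set there is one class, in accordance with the empty determinant 1.
cokernel-cardinality {zero} A _ = mkInverse {S = Cokernel A} {T = setoid (Fin 1)} (λ _ → zero) (λ _ ()) (λ _ → refl)
  (λ _ → (λ ()) by λ ()) (λ { zero → refl }) (λ _ → (λ ()) by λ ())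
cokernel-cardinality {suc k} A det≢0 =
  let B , A~B , zeros = clearFirstRow A (allFin k)
      zeros′ = λ j → All.lookup zeros (∈-allFin j)
  in transport B A~B zeros′
  where
  transport : ∀ B → ColumnEquivalent A B → (∀ j → B zero (suc j) ≡ 0ℤ) → HasCardinality (Cokernel A) ∣ det A ∣
  transport B A~B zeros = mkInverse {S = Cokernel A} {T = setoid (Fin ∣ det A ∣)} C.to C.from (λ x≈y → C.to-cong (A⇒B x≈y))
    (λ { refl → ≈-reflexive {A = A} λ _ → refl }) C.strictlyInverseˡ (λ x → B⇒A (C.strictlyInverseʳ x))
    where
    B′ : Matrix k
    B′ i j = B (suc i) (suc j)
    factors : det A ≡ B zero zero * det B′
    factors = trans (det-≡ A~B) (det-firstRow B zeros)
    A⇒B : ∀ {x y} → x ≈ y mod A → x ≈ y mod B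
    A⇒B {y = y} (z by eq) = let w , eq′ = ⊆ A~B z in w by λ i → trans (eq i) (cong (_+_ (y i)) (eq′ i))
    B⇒A : ∀ {x y} → x ≈ y mod B → x ≈ y mod A
    B⇒A {y = y} (z by eq) = let w , eq′ = ⊇ A~B z in w by λ i → trans (eq i) (cong (_+_ (y i)) (eq′ i))
    coker : HasCardinality (Cokernel B) ∣ det A ∣
    coker = subst (HasCardinality (Cokernel B)) (sym (trans (cong ∣_∣ factors) (ℤₚ.abs-* (B zero zero) (det B′))))
      (cokernel-firstRow B zeros {{ℤ.≢-nonZero {B zero zero} λ b≡0 → det≢0 (trans factors (cong (_* det B′) b≡0))}}
        (cokernel-cardinality B′ λ d≡0 → det≢0 (trans factors (trans (cong (B zero zero *_) d≡0) (ℤₚ.*-zeroʳ (B zero zero))))))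
    module C = Inverse coker

-- Sandpile dynamics

lookup-ext : ∀ {a n} {A : Set a} {x y : Vec A n} → (∀ i → lookup x i ≡ lookup y i) → x ≡ y
lookup-ext {x = x} {y} eq = trans (sym (tabulate∘lookup x)) (trans (tabulate-cong eq) (tabulate∘lookup y))

sum-mono-≤ : ∀ {k} {f g : Fin k → ℕ} → (∀ i → f i ℕ.≤ g i) → ℕΣ.sum f ℕ.≤ ℕΣ.sum g
sum-mono-≤ {zero}  f≤g = ℕ.z≤n
sum-mono-≤ {suc k} f≤g = ℕₚ.+-mono-≤ (f≤g zero) (sum-mono-≤ (f≤g ∘ suc))

sum-mono-< : ∀ {k} {f g : Fin k → ℕ} → (∀ i → f i ℕ.≤ g i) → ∀ j → f j ℕ.< g j → ℕΣ.sum f ℕ.< ℕΣ.sum g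
sum-mono-< f≤g zero    f<g = ℕₚ.+-mono-<-≤ f<g (sum-mono-≤ (f≤g ∘ suc))
sum-mono-< f≤g (suc j) f<g = ℕₚ.+-mono-≤-< (f≤g zero) (sum-mono-< (f≤g ∘ suc) j f<g)

-- Lets a sum stand in for a maximum wherever a bound common to finitely many numbers is wanted.
term≤sum : ∀ {k} (f : Fin k → ℕ) i → f i ℕ.≤ ℕΣ.sum f
term≤sum f zero    = ℕₚ.m≤m+n (f zero) _
term≤sum f (suc i) = ℕₚ.≤-trans (term≤sum (f ∘ suc) i) (ℕₚ.m≤n+m _ (f zero))

-- The path condition provides a function that is strictly superharmonic away from the sink,
-- built layer by layer: multiplying the old function by a large number and adding the
-- indicator of the vertices not yet settled keeps the settled ones and settles their predecessors.
module Potential {n : ℕ} (Γ : SandpileGraph n) where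
  open SandpileGraph Γ

  Superharmonic : (Fin (suc n) → ℕ) → Fin (suc n) → Set
  Superharmonic h v = ℕΣ.sum (λ w → wt v w ℕ.* h w) ℕ.< outdeg v ℕ.* h v

  -- Unsettled vertices all carry the greatest value, so one edge to a vertex of smaller value
  -- suffices to settle them later.
  record Layer : Set where
    field
      h         : Fin (suc n) → ℕ
      bound     : ℕ
      settled   : Fin (suc n) → Bool
      h≤bound   : ∀ v → h v ℕ.≤ bound
      unsettled : ∀ v → settled v ≡ false → h v ≡ bound
      harmonic  : ∀ v → settled v ≡ true → v ≢ sink → Superharmonic h v

  module Next (L : Layer) where
    open Layer L

    -- Larger than every outdegree. Scaling turns the slack 1 of a strict inequality at `v` into
    -- `factor`, while the added indicators raise the left side by at most `outdeg v`.
    factor : ℕ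
    factor = suc (ℕΣ.sum outdeg)

    χ : Bool → ℕ
    χ b = if b then 0 else 1

    χ≤1 : ∀ b → χ b ℕ.≤ 1
    χ≤1 true  = ℕ.z≤n
    χ≤1 false = ℕₚ.≤-refl

    h′ : Fin (suc n) → ℕ
    h′ w = factor ℕ.* h w ℕ.+ χ (settled w)

    bound′ : ℕ
    bound′ = factor ℕ.* bound ℕ.+ 1

    settledNeighbour? : ∀ v → Dec (∃[ w ] Edge v w × settled w ≡ true)
    settledNeighbour? v = any? λ w → (0 ℕₚ.<? wt v w) ×-dec (settled w Boolₚ.≟ true)

    settled′ : Fin (suc n) → Bool
    settled′ v = settled v ∨ does (settledNeighbour? v)

    h′≤bound′ : ∀ v → h′ v ℕ.≤ bound′
    h′≤bound′ v = ℕₚ.+-mono-≤ (ℕₚ.*-monoʳ-≤ factor (h≤bound v)) (χ≤1 (settled v))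

    unsettled′ : ∀ v → settled′ v ≡ false → h′ v ≡ bound′
    unsettled′ v eq with settled v in s
    ... | false = cong (λ x → factor ℕ.* x ℕ.+ 1) (unsettled v s)

    stays : ∀ v → settled v ≡ true → v ≢ sink → Superharmonic h′ v
    stays v s v≢sink = begin-strict
      ℕΣ.sum (λ w → wt v w ℕ.* h′ w)
        ≡⟨ ℕΣ.sum-cong-≗ (λ w → distribute (wt v w) factor (h w) (χ (settled w))) ⟩
      ℕΣ.sum (λ w → factor ℕ.* (wt v w ℕ.* h w) ℕ.+ wt v w ℕ.* χ (settled w))
        ≡⟨ ℕΣ.∑-distrib-+ (λ w → factor ℕ.* (wt v w ℕ.* h w)) (λ w → wt v w ℕ.* χ (settled w)) ⟩
      ℕΣ.sum (λ w → factor ℕ.* (wt v w ℕ.* h w)) ℕ.+ ℕΣ.sum (λ w → wt v w ℕ.* χ (settled w))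
        ≤⟨ ℕₚ.+-mono-≤ (ℕₚ.≤-reflexive (sym (ℕΣ*.*-distribˡ-sum factor (λ w → wt v w ℕ.* h w))))
             (sum-mono-≤ λ w → ℕₚ.≤-trans (ℕₚ.*-monoʳ-≤ (wt v w) (χ≤1 (settled w))) (ℕₚ.≤-reflexive (ℕₚ.*-identityʳ (wt v w)))) ⟩
      factor ℕ.* S ℕ.+ outdeg v
        <⟨ ℕₚ.+-monoʳ-< (factor ℕ.* S) (ℕ.s≤s (term≤sum outdeg v)) ⟩
      factor ℕ.* S ℕ.+ factor
        ≡⟨ trans (ℕₚ.+-comm (factor ℕ.* S) factor) (sym (ℕₚ.*-suc factor S)) ⟩
      factor ℕ.* suc S
        ≤⟨ ℕₚ.*-monoʳ-≤ factor (harmonic v s v≢sink) ⟩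
      factor ℕ.* (outdeg v ℕ.* h v)
        ≡⟨ swap-factors factor (outdeg v) (h v) ⟩
      outdeg v ℕ.* (factor ℕ.* h v ℕ.+ 0)
        ≡⟨ cong (λ b → outdeg v ℕ.* (factor ℕ.* h v ℕ.+ χ b)) s ⟨
      outdeg v ℕ.* h′ v ∎
      where
      open ℕₚ.≤-Reasoning
      S = ℕΣ.sum (λ w → wt v w ℕ.* h w)
      distribute : ∀ a b c d → a ℕ.* (b ℕ.* c ℕ.+ d) ≡ b ℕ.* (a ℕ.* c) ℕ.+ a ℕ.* d
      distribute = ℕ-Solver.solve-∀
      swap-factors : ∀ a b c → a ℕ.* (b ℕ.* c) ≡ b ℕ.* (a ℕ.* c ℕ.+ 0)
      swap-factors = ℕ-Solver.solve-∀

    -- The values at all out-neighbours are at most `h′ v`, which is `bound′`, and the one at the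
    -- settled `w` is strictly smaller as its indicator is 0.
    joins : ∀ v → settled v ≡ false → ∀ {w} → Edge v w → settled w ≡ true → Superharmonic h′ v
    joins v s {w} edge sw = begin-strict
      ℕΣ.sum (λ u → wt v u ℕ.* h′ u)
        <⟨ sum-mono-< (λ u → ℕₚ.*-monoʳ-≤ (wt v u) (h′≤bound′ u)) w (ℕₚ.*-monoʳ-< (wt v w) {{ℕ.>-nonZero edge}} h′w<bound′) ⟩
      ℕΣ.sum (λ u → wt v u ℕ.* bound′)
        ≡⟨ ℕΣ*.*-distribʳ-sum bound′ (wt v) ⟨
      outdeg v ℕ.* bound′
        ≡⟨ cong (outdeg v ℕ.*_) (cong₂ (λ b x → factor ℕ.* x ℕ.+ χ b) s (unsettled v s)) ⟨
      outdeg v ℕ.* h′ v ∎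
      where
      open ℕₚ.≤-Reasoning
      h′w<bound′ : h′ w ℕ.< bound′
      h′w<bound′ = subst (λ b → factor ℕ.* h w ℕ.+ χ b ℕ.< bound′) (sym sw)
        (ℕₚ.+-mono-≤-< (ℕₚ.*-monoʳ-≤ factor (h≤bound w)) ℕₚ.≤-refl)

    harmonic′ : ∀ v → settled′ v ≡ true → v ≢ sink → Superharmonic h′ v
    harmonic′ v eq v≢sink = cases (settled v) refl (settledNeighbour? v) eq
      where
      cases : ∀ b → settled v ≡ b → (d : Dec (∃[ w ] Edge v w × settled w ≡ true)) → b ∨ does d ≡ true → Superharmonic h′ v
      cases true  s _ _ = stays v s v≢sink
      cases false s (yes (w , edge , sw)) _ = joins v s edge sw

    next : Layer
    next = record { h = h′ ; bound = bound′ ; settled = settled′ ; h≤bound = h′≤bound′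
                  ; unsettled = unsettled′ ; harmonic = harmonic′ }

    next-monotone : ∀ v → settled v ≡ true → settled′ v ≡ true
    next-monotone v s = cong (_∨ does (settledNeighbour? v)) s

    next-edge : ∀ {v w} → Edge v w → settled w ≡ true → settled′ v ≡ true
    next-edge {v} {w} edge s = trans
      (cong (settled v ∨_) (dec-true (settledNeighbour? v) (w , edge , s))) (Boolₚ.∨-zeroʳ (settled v))

  open Layer

  layer : ℕ → Layer
  layer zero = record
    { h = λ _ → 0 ; bound = 0 ; settled = λ v → does (v ≟ sink)
    ; h≤bound = λ _ → ℕ.z≤n ; unsettled = λ _ _ → refl
    ; harmonic = λ v s v≢sink → contradiction (trans (sym s) (dec-false (v ≟ sink) v≢sink)) λ () }
  layer (suc k) = Next.next (layer k)

  layer-monotone : ∀ {k m} → k ℕ.≤ m → ∀ v → settled (layer k) v ≡ true → settled (layer m) v ≡ true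
  layer-monotone k≤m v s = go (ℕₚ.≤⇒≤′ k≤m)
    where
    go : ∀ {m} → _ ℕ.≤′ m → settled (layer m) v ≡ true
    go ℕ.≤′-refl = s
    go {suc m} (ℕ.≤′-step k≤m) = Next.next-monotone (layer m) v (go k≤m)

  path-settles : ∀ {v} → Star Edge v sink → ∃[ k ] settled (layer k) v ≡ true
  path-settles ε = 0 , dec-true (sink ≟ sink) refl
  path-settles (edge ◅ path) = let k , s = path-settles path in suc k , Next.next-edge (layer k) edge s

  potential : ∃[ h ] ∀ v → v ≢ sink → Superharmonic h v
  potential = h (layer K) , λ v → harmonic (layer K) v
      (layer-monotone (term≤sum levels v) v (proj₂ (path-settles (pathToSink v))))
    where
    levels : Fin (suc n) → ℕ
    levels v = proj₁ (path-settles (pathToSink v))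
    K = ℕΣ.sum levels

-- Firing: exchange, confluence and termination

module Toppling {n : ℕ} (Γ : SandpileGraph n) where
  open SandpileGraph Γ
  open Sandpile Γ

  -- Transposed so that `Δ̃ᵀ *ᵥ σ` is the total change, with sign reversed, caused by firing each
  -- `u` `σ u` times.
  Δ̃ᵀ : Fin n → Fin n → ℤ
  Δ̃ᵀ w u = Δ̃ u w

  _⟶*_ : Config → Config → Set
  _⟶*_ = Star _⟶_

  ≤⇒+-∸ : ∀ {m n} → n ℕ.≤ m → + (m ℕ.∸ n) ≡ + m + - + n
  ≤⇒+-∸ {m} {n} n≤m = trans (sym (ℤₚ.⊖-≥ n≤m)) (sym (ℤₚ.m-n≡m⊖n m n))

  lookup-fire : ∀ c {v} → Unstable c v → ∀ w → + lookup (fire v c) w ≡ + lookup c w + - Δ̃ v w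
  lookup-fire c {v} unstable w = trans (cong +_ (lookup∘tabulate _ w)) entry
    where
    t = wt (ι v) (ι w)
    rearrange : ∀ x o t → (x + - o) + t ≡ x + - (o + - t)
    rearrange = solve-∀
    entry : + (lookup c w ℕ.∸ (if does (v ≟ w) then outdeg (ι v) else 0) ℕ.+ t) ≡ + lookup c w + - Δ̃ v w
    entry with v ≟ w
    ... | yes refl = trans (cong (_+ + t) (≤⇒+-∸ unstable)) (rearrange (+ lookup c w) (+ outdeg (ι v)) (+ t))
    ... | no _     = trans (cong (_+ + t) (sym (ℤₚ.+-identityʳ (+ lookup c w)))) (rearrange (+ lookup c w) 0ℤ (+ t))

  ⟶-intro : ∀ c d v → Unstable c v → (∀ w → + lookup d w ≡ + lookup c w + - Δ̃ v w) → c ⟶ d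
  ⟶-intro c d v unstable eq = v , unstable ,
    lookup-ext λ w → ℤₚ.+-injective (trans (eq w) (sym (lookup-fire c unstable w)))

  Δ̃-off-diagonal : ∀ {v w} → v ≢ w → Δ̃ v w ≡ - + wt (ι v) (ι w)
  Δ̃-off-diagonal {v} {w} v≢w with v ≟ w
  ... | yes v≡w = contradiction v≡w v≢w
  ... | no _    = ℤₚ.+-identityˡ _

  fire-≢ : ∀ c {v} → Unstable c v → ∀ {w} → v ≢ w → lookup c w ℕ.≤ lookup (fire v c) w
  fire-≢ c {v} unstable {w} v≢w = ℤₚ.drop‿+≤+ (begin
    + lookup c w                        ≤⟨ ℤₚ.i≤i+j (+ lookup c w) (+ wt (ι v) (ι w)) ⟩
    + lookup c w + + wt (ι v) (ι w)     ≡⟨ cong (_+_ (+ lookup c w)) (trans (cong -_ (Δ̃-off-diagonal v≢w)) (ℤₚ.neg-involutive _)) ⟨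
    + lookup c w + - Δ̃ v w              ≡⟨ lookup-fire c unstable w ⟨
    + lookup (fire v c) w               ∎)
    where open ℤₚ.≤-Reasoning

  lookup-⊕ : ∀ c d w → + lookup (c ⊕ d) w ≡ + lookup c w + + lookup d w
  lookup-⊕ c d w = cong +_ (lookup-zipWith ℕ._+_ w c d)

  ⊕-mono-⟶ : ∀ r {c d} → c ⟶ d → (c ⊕ r) ⟶ (d ⊕ r)
  ⊕-mono-⟶ r {c} (v , unstable , refl) = ⟶-intro (c ⊕ r) (fire v c ⊕ r) v
    (ℕₚ.≤-trans unstable (ℕₚ.≤-trans (ℕₚ.m≤m+n _ (lookup r v)) (ℕₚ.≤-reflexive (sym (lookup-zipWith ℕ._+_ v c r)))))
    λ w → begin
      + lookup (fire v c ⊕ r) w                  ≡⟨ trans (lookup-⊕ (fire v c) r w) (cong (_+ + lookup r w) (lookup-fire c unstable w)) ⟩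
      (+ lookup c w + - Δ̃ v w) + + lookup r w    ≡⟨ rearrange (+ lookup c w) (Δ̃ v w) (+ lookup r w) ⟩
      (+ lookup c w + + lookup r w) + - Δ̃ v w    ≡⟨ cong (_+ - Δ̃ v w) (lookup-⊕ c r w) ⟨
      + lookup (c ⊕ r) w + - Δ̃ v w               ∎
    where
    open ≡-Reasoning
    rearrange : ∀ x y z → (x + - y) + z ≡ (x + z) + - y
    rearrange = solve-∀

  ⊕-mono-⟶* : ∀ r {c d} → c ⟶* d → (c ⊕ r) ⟶* (d ⊕ r)
  ⊕-mono-⟶* r = gmap (_⊕ r) (λ {c} {d} → ⊕-mono-⟶ r {c} {d})

  diamond : ∀ c {u v} → Unstable c u → Unstable c v → u ≢ v → ∃[ d ] fire u c ⟶ d × fire v c ⟶ d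
  diamond c {u} {v} unstable-u unstable-v u≢v =
    fire v (fire u c) , (v , v-still , refl) ,
    ⟶-intro (fire v c) (fire v (fire u c)) u u-still λ w → begin
      + lookup (fire v (fire u c)) w               ≡⟨ trans (lookup-fire (fire u c) v-still w) (cong (_+ - Δ̃ v w) (lookup-fire c unstable-u w)) ⟩
      (+ lookup c w + - Δ̃ u w) + - Δ̃ v w           ≡⟨ rearrange (+ lookup c w) (Δ̃ u w) (Δ̃ v w) ⟩
      (+ lookup c w + - Δ̃ v w) + - Δ̃ u w           ≡⟨ cong (_+ - Δ̃ u w) (lookup-fire c unstable-v w) ⟨
      + lookup (fire v c) w + - Δ̃ u w              ∎
    where
    open ≡-Reasoning
    v-still : Unstable (fire u c) v
    v-still = ℕₚ.≤-trans unstable-v (fire-≢ c unstable-u u≢v)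
    u-still : Unstable (fire v c) u
    u-still = ℕₚ.≤-trans unstable-u (fire-≢ c unstable-v (u≢v ∘ sym))
    rearrange : ∀ x y z → (x + - y) + - z ≡ (x + - z) + - y
    rearrange = solve-∀

  -- Induction along the path to `s`: if its first firing is not that of `v`, both firings commute,
  -- and the step at `v` is pushed further down the path. It must meet a firing of `v`, since `v`
  -- cannot remain unstable in `s`.
  confluence-step : ∀ {c d s} → Stable s → c ⟶* s → c ⟶ d → d ⟶* s
  confluence-step stable ε (v , unstable , _) = contradiction unstable (ℕₚ.<⇒≱ (stable v))
  confluence-step {c} stable ((u , unstable-u , refl) ◅ path) (v , unstable-v , refl) with u ≟ v
  ... | yes refl = path
  ... | no u≢v   = let d , left , right = diamond c unstable-u unstable-v u≢v
                   in right ◅ confluence-step stable path left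

  confluence : ∀ {c d s} → Stable s → c ⟶* s → c ⟶* d → d ⟶* s
  confluence stable c⟶*s ε = c⟶*s
  confluence stable c⟶*s (step ◅ path) = confluence stable (confluence-step stable c⟶*s step) path

  stable-unique : ∀ {c s t} → Stable s → Stable t → c ⟶* s → c ⟶* t → s ≡ t
  stable-unique stable-s stable-t c⟶*s c⟶*t with confluence stable-s c⟶*s c⟶*t
  ... | ε = refl
  ... | (v , unstable , _) ◅ _ = contradiction unstable (ℕₚ.<⇒≱ (stable-t v))

  open Potential Γ using (potential)

  private
    h : Fin n → ℕ
    h = proj₁ potential ∘ ι

    superharmonic : ∀ v → ℕΣ.sum (λ w → wt (ι v) (ι w) ℕ.* h w) ℕ.< outdeg (ι v) ℕ.* h v
    superharmonic v = ℕₚ.≤-<-trans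
      (ℕₚ.≤-trans (ℕₚ.m≤n+m _ (wt (ι v) sink ℕ.* proj₁ potential sink))
        (ℕₚ.≤-reflexive (sym (ℕΣ.sum-remove {i = sink} (λ w → wt (ι v) w ℕ.* proj₁ potential w)))))
      (proj₂ potential (ι v) (punchInᵢ≢i sink v))

  -- A weighted number of grains. The plain number stays the same when a vertex without an edge to
  -- the sink fires; with superharmonic weights every firing lowers the total.
  energy : Config → ℕ
  energy c = ℕΣ.sum λ w → lookup c w ℕ.* h w

  fire-energy : ∀ c {v} → Unstable c v → energy (fire v c) ℕ.< energy c
  -- The grains lost at `v` are added back on both sides, which removes the truncated subtraction
  -- from the comparison.
  fire-energy c {v} unstable = ℕₚ.+-cancelʳ-< (outdeg (ι v) ℕ.* h v) _ _ (begin-strict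
    energy (fire v c) ℕ.+ outdeg (ι v) ℕ.* h v
      ≡⟨ sum-update ℕₚ.+-0-commutativeMonoid v other same ⟨
    ℕΣ.sum (λ w → (lookup c w ℕ.+ wt (ι v) (ι w)) ℕ.* h w)
      ≡⟨ ℕΣ.sum-cong-≗ (λ w → ℕₚ.*-distribʳ-+ (h w) (lookup c w) (wt (ι v) (ι w))) ⟩
    ℕΣ.sum (λ w → lookup c w ℕ.* h w ℕ.+ wt (ι v) (ι w) ℕ.* h w)
      ≡⟨ ℕΣ.∑-distrib-+ (λ w → lookup c w ℕ.* h w) (λ w → wt (ι v) (ι w) ℕ.* h w) ⟩
    energy c ℕ.+ ℕΣ.sum (λ w → wt (ι v) (ι w) ℕ.* h w)
      <⟨ ℕₚ.+-monoʳ-< (energy c) (superharmonic v) ⟩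
    energy c ℕ.+ outdeg (ι v) ℕ.* h v ∎)
    where
    open ℕₚ.≤-Reasoning
    other : ∀ w → w ≢ v → (lookup c w ℕ.+ wt (ι v) (ι w)) ℕ.* h w ≡ lookup (fire v c) w ℕ.* h w
    other w w≢v = cong (ℕ._* h w) (sym (trans (lookup∘tabulate _ w)
      (cong (λ b → lookup c w ℕ.∸ (if b then outdeg (ι v) else 0) ℕ.+ wt (ι v) (ι w)) (dec-false (v ≟ w) (w≢v ∘ sym)))))
    same : (lookup c v ℕ.+ wt (ι v) (ι v)) ℕ.* h v ≡ lookup (fire v c) v ℕ.* h v ℕ.+ outdeg (ι v) ℕ.* h v
    same = trans (cong (ℕ._* h v) (begin-equality
      lookup c v ℕ.+ t                           ≡⟨ cong (ℕ._+ t) (ℕₚ.m∸n+n≡m unstable) ⟨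
      (lookup c v ℕ.∸ o) ℕ.+ o ℕ.+ t             ≡⟨ rearrange (lookup c v ℕ.∸ o) o t ⟩
      ((lookup c v ℕ.∸ o) ℕ.+ t) ℕ.+ o           ≡⟨ cong (ℕ._+ o) (trans (lookup∘tabulate _ v)
                                                      (cong (λ b → lookup c v ℕ.∸ (if b then o else 0) ℕ.+ t) (dec-true (v ≟ v) refl))) ⟨
      lookup (fire v c) v ℕ.+ o                  ∎)) (ℕₚ.*-distribʳ-+ (h v) (lookup (fire v c) v) o)
      where
      o = outdeg (ι v)
      t = wt (ι v) (ι v)
      rearrange : ∀ a b c → a ℕ.+ b ℕ.+ c ≡ a ℕ.+ c ℕ.+ b
      rearrange = ℕ-Solver.solve-∀

  ⟦_⟧ : (Fin n → ℕ) → Fin n → ℤ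
  ⟦ σ ⟧ w = + σ w

  -- Firing a vertex does not lower the others, so grains sufficient at the outset suffice throughout.
  fireScript : ∀ s (σ : Fin n → ℕ) → ℕΣ.sum σ ≡ s → ∀ x → (∀ w → σ w ℕ.* outdeg (ι w) ℕ.≤ lookup x w) →
    ∃[ y ] x ⟶* y × (∀ w → + lookup y w ≡ + lookup x w + - (Δ̃ᵀ *ᵥ ⟦ σ ⟧) w) × energy y ℕ.+ s ℕ.≤ energy x
  fireScript zero σ Σσ≡0 x _ = x , ε , (λ w → sym (trans
      (cong (λ t → + lookup x w + - t) (sum-zero λ u → trans (cong (λ t → Δ̃ u w * + t) (σ≡0 u)) (ℤₚ.*-zeroʳ (Δ̃ u w))))
      (ℤₚ.+-identityʳ _))) , ℕₚ.≤-reflexive (ℕₚ.+-identityʳ (energy x))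
    where
    σ≡0 : ∀ u → σ u ≡ 0
    σ≡0 u = ℕₚ.n≤0⇒n≡0 (subst (σ u ℕ.≤_) Σσ≡0 (term≤sum σ u))
  fireScript (suc s) σ Σσ≡1+s x enough with any? (λ u → 0 ℕₚ.<? σ u)
  ... | no none = contradiction (trans (sym Σσ≡1+s) (trans (ℕΣ.sum-cong-≗ λ u → ℕₚ.n≤0⇒n≡0 (ℕₚ.≮⇒≥ λ 0<σ → none (u , 0<σ))) (ℕΣ.sum-replicate-zero n))) λ ()
  ... | yes (u , 0<σu) = y , (u , unstable , refl) ◅ path , combined , energetic
    where
    σ′ : Fin n → ℕ
    σ′ w = σ w ℕ.∸ (if does (w ≟ u) then 1 else 0)
    σ′-≡ : σ u ≡ σ′ u ℕ.+ 1
    σ′-≡ = sym (trans (cong (λ b → σ u ℕ.∸ (if b then 1 else 0) ℕ.+ 1) (dec-true (u ≟ u) refl)) (ℕₚ.m∸n+n≡m 0<σu))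
    σ′-≢ : ∀ w → w ≢ u → σ w ≡ σ′ w
    σ′-≢ w w≢u = cong (λ b → σ w ℕ.∸ (if b then 1 else 0)) (sym (dec-false (w ≟ u) w≢u))
    unstable : Unstable x u
    unstable = ℕₚ.≤-trans (ℕₚ.m≤n*m (outdeg (ι u)) (σ u) {{ℕ.>-nonZero 0<σu}}) (enough u)
    Σσ′≡s : ℕΣ.sum σ′ ≡ s
    Σσ′≡s = ℕₚ.suc-injective (trans (ℕₚ.+-comm 1 (ℕΣ.sum σ′)) (trans (sym (sum-update ℕₚ.+-0-commutativeMonoid u σ′-≢ σ′-≡)) Σσ≡1+s))
    enough′ : ∀ w → σ′ w ℕ.* outdeg (ι w) ℕ.≤ lookup (fire u x) w
    enough′ w with w ≟ u
    ... | no w≢u = ℕₚ.≤-trans (enough w) (fire-≢ x unstable (w≢u ∘ sym))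
    ... | yes refl = begin
      (σ u ℕ.∸ 1) ℕ.* outdeg (ι u)               ≡⟨ trans (ℕₚ.*-distribʳ-∸ (outdeg (ι u)) (σ u) 1) (cong (σ u ℕ.* outdeg (ι u) ℕ.∸_) (ℕₚ.*-identityˡ (outdeg (ι u)))) ⟩
      σ u ℕ.* outdeg (ι u) ℕ.∸ outdeg (ι u)      ≤⟨ ℕₚ.∸-monoˡ-≤ (outdeg (ι u)) (enough u) ⟩
      lookup x u ℕ.∸ outdeg (ι u)                ≤⟨ ℕₚ.m≤m+n _ _ ⟩
      lookup x u ℕ.∸ outdeg (ι u) ℕ.+ wt (ι u) (ι u)
        ≡⟨ trans (lookup∘tabulate _ u) (cong (λ b → lookup x u ℕ.∸ (if b then outdeg (ι u) else 0) ℕ.+ wt (ι u) (ι u)) (dec-true (u ≟ u) refl)) ⟨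
      lookup (fire u x) u                        ∎
      where open ℕₚ.≤-Reasoning
    rec = fireScript s σ′ Σσ′≡s (fire u x) enough′
    y = proj₁ rec
    path = proj₁ (proj₂ rec)
    combined : ∀ w → + lookup y w ≡ + lookup x w + - (Δ̃ᵀ *ᵥ ⟦ σ ⟧) w
    combined w = begin
      + lookup y w                                                   ≡⟨ proj₁ (proj₂ (proj₂ rec)) w ⟩
      + lookup (fire u x) w + - (Δ̃ᵀ *ᵥ ⟦ σ′ ⟧) w                     ≡⟨ cong (_+ - (Δ̃ᵀ *ᵥ ⟦ σ′ ⟧) w) (lookup-fire x unstable w) ⟩
      (+ lookup x w + - Δ̃ u w) + - (Δ̃ᵀ *ᵥ ⟦ σ′ ⟧) w                  ≡⟨ rearrange (+ lookup x w) (Δ̃ u w) ((Δ̃ᵀ *ᵥ ⟦ σ′ ⟧) w) ⟩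
      + lookup x w + - ((Δ̃ᵀ *ᵥ ⟦ σ′ ⟧) w + Δ̃ u w)                    ≡⟨ cong (λ t → + lookup x w + - t) (sum-update ℤₚ.+-0-commutativeMonoid u
          (λ v v≢u → cong (λ t → Δ̃ v w * + t) (σ′-≢ v v≢u))
          (trans (cong (λ t → Δ̃ u w * + t) σ′-≡) (successor (Δ̃ u w) (+ σ′ u)))) ⟨
      + lookup x w + - (Δ̃ᵀ *ᵥ ⟦ σ ⟧) w                               ∎
      where
      open ≡-Reasoning
      rearrange : ∀ x a b → (x + - a) + - b ≡ x + - (b + a)
      rearrange = solve-∀
      successor : ∀ a b → a * (b + 1ℤ) ≡ a * b + a
      successor = solve-∀
    energetic : energy y ℕ.+ suc s ℕ.≤ energy x
    energetic = ℕₚ.≤-trans (ℕₚ.≤-reflexive (ℕₚ.+-suc (energy y) s))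
      (ℕₚ.≤-<-trans (proj₂ (proj₂ (proj₂ rec))) (fire-energy x unstable))

-- Group actions and symmetric configurations

lookup-injective : ∀ {a r} {A : Set a} {R : A → A → Set r} → (∀ {x y} → R x y → R y x) →
  ∀ {xs} → AllPairs (λ x y → ¬ R x y) xs → ∀ i j → R (List.lookup xs i) (List.lookup xs j) → i ≡ j
lookup-injective R-sym (_  ∷ _)   zero    zero    _   = refl
lookup-injective R-sym (x≉ ∷ _)   zero    (suc j) x≈y = contradiction x≈y (All.lookup x≉ (∈-lookup j))
lookup-injective R-sym (x≉ ∷ _)   (suc i) zero    x≈y = contradiction (R-sym x≈y) (All.lookup x≉ (∈-lookup i))
lookup-injective R-sym (_  ∷ xs!) (suc i) (suc j) x≈y = cong suc (lookup-injective R-sym xs! i j x≈y)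

module SymmetricSandpile {c ℓ : Level} {k n : ℕ} {G : Group c ℓ} (finite : HasCardinality (Group.setoid G) k)
                         {Γ : SandpileGraph n} (A : Action G Γ) where
  open Group G using (Carrier; _⁻¹; inverseˡ; inverseʳ)
  open SandpileGraph Γ
  open Sandpile Γ
  open Action A
  open Symmetric finite A
  open Toppling Γ

  ⁻¹-cancelˡ : ∀ g v → g ⁻¹ · g · v ≡ v
  ⁻¹-cancelˡ g v = trans (sym (·-∙ (g ⁻¹) g v)) (trans (·-cong (inverseˡ g) v) (·-ε v))

  ⁻¹-cancelʳ : ∀ g v → g · g ⁻¹ · v ≡ v
  ⁻¹-cancelʳ g v = trans (sym (·-∙ g (g ⁻¹) v)) (trans (·-cong (inverseʳ g) v) (·-ε v))

  ·-injective : ∀ g {v w} → g · v ≡ g · w → v ≡ w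
  ·-injective g {v} {w} eq = trans (sym (⁻¹-cancelˡ g v)) (trans (cong (g ⁻¹ ·_) eq) (⁻¹-cancelˡ g w))

  -- The action axiom speaks of edges only. A non-edge cannot become an edge, since `g ⁻¹` would
  -- carry that edge back.
  wt-invariant : ∀ g v w → wt (g · v) (g · w) ≡ wt v w
  wt-invariant g v w with 0 ℕₚ.<? wt v w | 0 ℕₚ.<? wt (g · v) (g · w)
  ... | yes edge | _        = proj₂ (·-edge g edge)
  ... | no none  | no none′ = trans (ℕₚ.n≤0⇒n≡0 (ℕₚ.≮⇒≥ none′)) (sym (ℕₚ.n≤0⇒n≡0 (ℕₚ.≮⇒≥ none)))
  ... | no none  | yes edge = contradiction
    (subst (0 ℕ.<_) (cong₂ wt (⁻¹-cancelˡ g v) (⁻¹-cancelˡ g w)) (proj₁ (·-edge (g ⁻¹) edge))) none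

  outdeg-invariant : ∀ g v → outdeg (g · v) ≡ outdeg v
  outdeg-invariant g v = trans
    (ℕΣ.sum-permute (wt (g · v)) (permutation (g ·_) (g ⁻¹ ·_) (⁻¹-cancelʳ g) (⁻¹-cancelˡ g)))
    (ℕΣ.sum-cong-≗ (wt-invariant g v))

  sink≢· : ∀ g v → sink ≢ g · ι v
  sink≢· g v eq = punchInᵢ≢i sink v (·-injective g (trans (sym eq) (sym (·-sink g))))

  infixr 7 _∗_
  _∗_ : Carrier → Fin n → Fin n
  g ∗ v = punchOut (sink≢· g v)

  ι-∗ : ∀ g v → ι (g ∗ v) ≡ g · ι v
  ι-∗ g v = punchIn-punchOut (sink≢· g v)

  ι-injective : ∀ {u v} → ι u ≡ ι v → u ≡ v
  ι-injective {u} {v} = punchIn-injective sink u v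

  ∗-cancelˡ : ∀ g v → g ⁻¹ ∗ g ∗ v ≡ v
  ∗-cancelˡ g v = ι-injective (trans (ι-∗ (g ⁻¹) (g ∗ v)) (trans (cong (g ⁻¹ ·_) (ι-∗ g v)) (⁻¹-cancelˡ g (ι v))))

  ∗-cancelʳ : ∀ g v → g ∗ g ⁻¹ ∗ v ≡ v
  ∗-cancelʳ g v = ι-injective (trans (ι-∗ g (g ⁻¹ ∗ v)) (trans (cong (g ·_) (ι-∗ (g ⁻¹) v)) (⁻¹-cancelʳ g (ι v))))

  ∗-injective : ∀ g {u v} → g ∗ u ≡ g ∗ v → u ≡ v
  ∗-injective g {u} {v} eq = trans (sym (∗-cancelˡ g u)) (trans (cong (g ⁻¹ ∗_) eq) (∗-cancelˡ g v))

  -- Constancy on orbits. For configurations it replaces `act g x ≡ x`, which involves a sum; it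
  -- also covers outdegrees, orbit indices and integer scripts.
  Invariant : ∀ {a} {X : Set a} → (Fin n → X) → Set _
  Invariant f = ∀ g v → f (g ∗ v) ≡ f v

  outdeg∘ι-invariant : Invariant (outdeg ∘ ι)
  outdeg∘ι-invariant g v = trans (cong outdeg (ι-∗ g v)) (outdeg-invariant g (ι v))

  -- As `g` is injective on vertices, only the term of `v` survives in the sum defining `act`.
  lookup-act : ∀ g x v → lookup (act g x) (g ∗ v) ≡ lookup x v
  lookup-act g x v = begin
    lookup (act g x) (g ∗ v)
      ≡⟨ lookup∘tabulate _ (g ∗ v) ⟩
    ℕΣ.sum (λ u → if does (g · ι u ≟ ι (g ∗ v)) then lookup x u else 0)
      ≡⟨ sum-update ℕₚ.+-0-commutativeMonoid v {lookup x v} {g = λ _ → 0}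
           (λ u u≢v → cong (λ b → if b then lookup x u else 0)
             (dec-false (g · ι u ≟ ι (g ∗ v)) λ eq → u≢v (ι-injective (·-injective g (trans eq (ι-∗ g v))))))
           (cong (λ b → if b then lookup x v else 0) (dec-true (g · ι v ≟ ι (g ∗ v)) (sym (ι-∗ g v)))) ⟩
    ℕΣ.sum {n} (λ _ → 0) ℕ.+ lookup x v
      ≡⟨ cong (ℕ._+ lookup x v) (ℕΣ.sum-replicate-zero n) ⟩
    lookup x v ∎
    where open ≡-Reasoning

  symmetric⇒invariant : ∀ {x} → IsSymmetric x → Invariant (lookup x)
  symmetric⇒invariant {x} symmetric g v = trans (cong (λ y → lookup y (g ∗ v)) (sym (symmetric g))) (lookup-act g x v)

  invariant⇒symmetric : ∀ {x} → Invariant (lookup x) → IsSymmetric x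
  invariant⇒symmetric {x} invariant g = lookup-ext λ w → begin
    lookup (act g x) w                   ≡⟨ cong (lookup (act g x)) (∗-cancelʳ g w) ⟨
    lookup (act g x) (g ∗ g ⁻¹ ∗ w)      ≡⟨ lookup-act g x (g ⁻¹ ∗ w) ⟩
    lookup x (g ⁻¹ ∗ w)                  ≡⟨ invariant (g ⁻¹) w ⟩
    lookup x w                           ∎
    where open ≡-Reasoning

  orbit-refl : ∀ {u} → u ∈Orbit u
  orbit-refl {u} = Group.ε G , ·-ε (ι u)

  orbit-sym : ∀ {u v} → u ∈Orbit v → v ∈Orbit u
  orbit-sym {u} {v} (g , eq) = g ⁻¹ , trans (cong (g ⁻¹ ·_) (sym eq)) (⁻¹-cancelˡ g (ι v))

  orbit-trans : ∀ {u v w} → u ∈Orbit v → v ∈Orbit w → u ∈Orbit w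
  orbit-trans {w = w} (g , eq) (g′ , eq′) = Group._∙_ G g g′ , trans (·-∙ g g′ (ι w)) (trans (cong (g ·_) eq′) eq)

  orbitDecSetoid : DecSetoid _ _
  orbitDecSetoid = record
    { Carrier = Fin n ; _≈_ = _∈Orbit_
    ; isDecEquivalence = record
      { isEquivalence = record { refl = orbit-refl ; sym = orbit-sym ; trans = orbit-trans } ; _≟_ = _∈Orbit?_ } }

  invariant-orbit : ∀ {a} {X : Set a} {f : Fin n → X} → Invariant f → ∀ {u v} → u ∈Orbit v → f u ≡ f v
  invariant-orbit {f = f} invariant {u} {v} (g , eq) =
    trans (cong f (ι-injective (trans (sym eq) (sym (ι-∗ g v))))) (invariant g v)

  private
    listed : ∀ u → Any (u ∈Orbit_) orbits
    listed u = Anyₚ.deduplicate⁺ _∈Orbit?_ (λ v∈w u∈w → orbit-trans u∈w (orbit-sym v∈w))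
      (lose (∈-allFin u) orbit-refl)

  cls : Fin n → Fin ∣𝒪∣
  cls u = Any.index (listed u)

  ∈-cls : ∀ u → u ∈Orbit rep (cls u)
  ∈-cls u = Anyₚ.lookup-index (listed u)

  rep-injective : ∀ {i j} → rep i ∈Orbit rep j → i ≡ j
  rep-injective {i} {j} = lookup-injective orbit-sym (deduplicate-! orbitDecSetoid (allFin n)) i j

  cls-unique : ∀ {u j} → u ∈Orbit rep j → cls u ≡ j
  cls-unique {u} u∈j = rep-injective (orbit-trans (orbit-sym (∈-cls u)) u∈j)

  cls-rep : ∀ i → cls (rep i) ≡ i
  cls-rep i = cls-unique orbit-refl

  cls-≡⇒orbit : ∀ {u v} → cls u ≡ cls v → u ∈Orbit v
  cls-≡⇒orbit {u} {v} eq = orbit-trans (∈-cls u) (subst (λ i → rep i ∈Orbit v) (sym eq) (orbit-sym (∈-cls v)))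

  cls-invariant : Invariant cls
  cls-invariant g v = cls-unique (orbit-trans (g , sym (ι-∗ g v)) (∈-cls v))

  ∘cls-invariant : ∀ {a} {X : Set a} (f : Fin ∣𝒪∣ → X) → Invariant (f ∘ cls)
  ∘cls-invariant f g v = cong f (cls-invariant g v)

  Δ̃-equivariant : ∀ g u w → Δ̃ (g ∗ u) (g ∗ w) ≡ Δ̃ u w
  Δ̃-equivariant g u w = cong₂ (λ o t → o + - + t) diagonal
    (trans (cong₂ wt (ι-∗ g u) (ι-∗ g w)) (wt-invariant g (ι u) (ι w)))
    where
    diagonal : (if does (g ∗ u ≟ g ∗ w) then + outdeg (ι (g ∗ u)) else 0ℤ) ≡ (if does (u ≟ w) then + outdeg (ι u) else 0ℤ)
    diagonal with u ≟ w
    ... | yes refl = trans (cong (if_then + outdeg (ι (g ∗ u)) else 0ℤ) (dec-true (g ∗ u ≟ g ∗ u) refl))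
      (cong +_ (trans (cong outdeg (ι-∗ g u)) (outdeg-invariant g (ι u))))
    ... | no u≢w   = cong (if_then + outdeg (ι (g ∗ u)) else 0ℤ) (dec-false (g ∗ u ≟ g ∗ w) (u≢w ∘ ∗-injective g))

  Δ̃ᵀ-invariant : ∀ {σ} → Invariant σ → Invariant (Δ̃ᵀ *ᵥ σ)
  Δ̃ᵀ-invariant {σ} invariant g w = trans
    (ℤΣ.sum-permute (λ u → Δ̃ u (g ∗ w) * σ u) (permutation (g ∗_) (g ⁻¹ ∗_) (∗-cancelʳ g) (∗-cancelˡ g)))
    (ℤΣ.sum-cong-≗ λ u → cong₂ _*_ (Δ̃-equivariant g u w) (invariant g u))

  -- The bridge between orbits and vertices: after exchanging the sums, each vertex `u` meets
  -- exactly one listed orbit, its own, and takes over the coefficient of that orbit.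
  Δ̃ᴳ-*ᵥ : ∀ z i → (Δ̃ᴳ *ᵥ z) i ≡ (Δ̃ᵀ *ᵥ (z ∘ cls)) (rep i)
  Δ̃ᴳ-*ᵥ z i = begin
    ℤΣ.sum (λ j → ℤΣ.sum (entry j) * z j)          ≡⟨ ℤΣ.sum-cong-≗ (λ j → ℤΣ*.*-distribʳ-sum (z j) (entry j)) ⟩
    ℤΣ.sum (λ j → ℤΣ.sum (λ u → entry j u * z j))  ≡⟨ ℤΣ.∑-comm (λ j u → entry j u * z j) ⟩
    ℤΣ.sum (λ u → ℤΣ.sum (λ j → entry j u * z j))  ≡⟨ ℤΣ.sum-cong-≗ collect ⟩
    ℤΣ.sum (λ u → Δ̃ u (rep i) * z (cls u))         ∎
    where
    open ≡-Reasoning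
    entry : Fin ∣𝒪∣ → Fin n → ℤ
    entry j u = if does (u ∈Orbit? rep j) then Δ̃ u (rep i) else 0ℤ
    collect : ∀ u → ℤΣ.sum (λ j → entry j u * z j) ≡ Δ̃ u (rep i) * z (cls u)
    collect u = trans (sum-update ℤₚ.+-0-commutativeMonoid (cls u) {g = λ _ → 0ℤ}
      (λ j j≢ → cong (λ b → (if b then Δ̃ u (rep i) else 0ℤ) * z j)
        (dec-false (u ∈Orbit? rep j) (λ u∈j → j≢ (sym (cls-unique u∈j)))))
      (trans (cong (λ b → (if b then Δ̃ u (rep i) else 0ℤ) * z (cls u)) (dec-true (u ∈Orbit? rep (cls u)) (∈-cls u)))
             (sym (ℤₚ.+-identityˡ _))))
      (trans (cong (_+ Δ̃ u (rep i) * z (cls u)) (sum-zero {∣𝒪∣} λ _ → refl)) (ℤₚ.+-identityˡ _))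

  -- Stabilization by whole orbits

  Stabilization : Config → Config → Set _
  Stabilization x s = Stable s × Invariant (lookup s) × x ⟶* s ×
    ∃[ τ ] ∀ w → + lookup s w ≡ + lookup x w + - (Δ̃ᵀ *ᵥ ⟦ τ ∘ cls ⟧) w

  -- `x` and the outdegrees are constant on orbits, so the whole orbit of an unstable vertex can be
  -- fired once; equivariance of `Δ̃` keeps the result symmetric. Recording the script per orbit is
  -- what places the change from `x` to `s` in the image of `Δ̃ᴳ`.
  stabilize : ∀ x → Invariant (lookup x) → Acc ℕ._<_ (energy x) → ∃[ s ] Stabilization x s
  stabilize x invariant (acc rs) with any? (λ v → outdeg (ι v) ℕₚ.≤? lookup x v)
  ... | no stable = x , (λ v → ℕₚ.≰⇒> λ unstable → stable (v , unstable)) , invariant , ε , (λ _ → 0) , λ w →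
    sym (trans (cong (λ t → + lookup x w + - t) (*ᵥ-zero Δ̃ᵀ w)) (ℤₚ.+-identityʳ _))
  ... | yes (v , unstable) = s , stable-s , invariant-s , x⟶*y ◅◅ y⟶*s , (λ j → τ₀ j ℕ.+ τ j) , λ w → begin
      + lookup s w
        ≡⟨ eq-s w ⟩
      + lookup y w + - (Δ̃ᵀ *ᵥ ⟦ τ ∘ cls ⟧) w
        ≡⟨ cong (_+ - (Δ̃ᵀ *ᵥ ⟦ τ ∘ cls ⟧) w) (eq-y w) ⟩
      (+ lookup x w + - (Δ̃ᵀ *ᵥ ⟦ τ₀ ∘ cls ⟧) w) + - (Δ̃ᵀ *ᵥ ⟦ τ ∘ cls ⟧) w
        ≡⟨ rearrange (+ lookup x w) ((Δ̃ᵀ *ᵥ ⟦ τ₀ ∘ cls ⟧) w) ((Δ̃ᵀ *ᵥ ⟦ τ ∘ cls ⟧) w) ⟩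
      + lookup x w + - (1ℤ * (Δ̃ᵀ *ᵥ ⟦ τ₀ ∘ cls ⟧) w + 1ℤ * (Δ̃ᵀ *ᵥ ⟦ τ ∘ cls ⟧) w)
        ≡⟨ cong (λ t → + lookup x w + - t) (*ᵥ-linear Δ̃ᵀ 1ℤ 1ℤ ⟦ τ₀ ∘ cls ⟧ ⟦ τ ∘ cls ⟧ w) ⟨
      + lookup x w + - (Δ̃ᵀ *ᵥ (λ u → 1ℤ * + τ₀ (cls u) + 1ℤ * + τ (cls u))) w
        ≡⟨ cong (λ t → + lookup x w + - t) (*ᵥ-cong Δ̃ᵀ (λ u → cong₂ _+_ (ℤₚ.*-identityˡ (+ τ₀ (cls u))) (ℤₚ.*-identityˡ (+ τ (cls u)))) w) ⟩
      + lookup x w + - (Δ̃ᵀ *ᵥ ⟦ (λ u → τ₀ (cls u) ℕ.+ τ (cls u)) ⟧) w ∎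
    where
    open ≡-Reasoning
    τ₀ : Fin ∣𝒪∣ → ℕ
    τ₀ j = if does (j ≟ cls v) then 1 else 0
    enough : ∀ w → τ₀ (cls w) ℕ.* outdeg (ι w) ℕ.≤ lookup x w
    enough w with cls w ≟ cls v
    ... | no _ = ℕ.z≤n
    ... | yes eq = ℕₚ.≤-trans (ℕₚ.≤-reflexive (trans (ℕₚ.*-identityˡ (outdeg (ι w)))
        (invariant-orbit outdeg∘ι-invariant w∈v)))
        (ℕₚ.≤-trans unstable (ℕₚ.≤-reflexive (sym (invariant-orbit invariant w∈v))))
      where
      w∈v : w ∈Orbit v
      w∈v = cls-≡⇒orbit eq
    fired = fireScript (ℕΣ.sum (τ₀ ∘ cls)) (τ₀ ∘ cls) refl x enough
    y = proj₁ fired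
    x⟶*y = proj₁ (proj₂ fired)
    eq-y = proj₁ (proj₂ (proj₂ fired))
    -- The script contains at least the firing of `v`, so the energy bound of `fireScript` is
    -- strict.
    energy-y : energy y ℕ.< energy x
    energy-y = ℕₚ.<-≤-trans (ℕₚ.m<m+n (energy y)
      (ℕₚ.≤-trans (ℕₚ.≤-reflexive (cong (if_then 1 else 0) (sym (dec-true (cls v ≟ cls v) refl)))) (term≤sum (τ₀ ∘ cls) v)))
      (proj₂ (proj₂ (proj₂ fired)))
    invariant-y : Invariant (lookup y)
    invariant-y g w = ℤₚ.+-injective (trans (eq-y (g ∗ w)) (trans
      (cong₂ (λ a b → + a + - b) (invariant g w) (Δ̃ᵀ-invariant (∘cls-invariant (λ j → + τ₀ j)) g w)) (sym (eq-y w))))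
    rec = stabilize y invariant-y (rs energy-y)
    s = proj₁ rec
    stable-s = proj₁ (proj₂ rec)
    invariant-s = proj₁ (proj₂ (proj₂ rec))
    y⟶*s = proj₁ (proj₂ (proj₂ (proj₂ rec)))
    τ = proj₁ (proj₂ (proj₂ (proj₂ (proj₂ rec))))
    eq-s = proj₂ (proj₂ (proj₂ (proj₂ (proj₂ rec))))
    rearrange : ∀ x a b → (x + - a) + - b ≡ x + - (1ℤ * a + 1ℤ * b)
    rearrange = solve-∀

  -- Absorption and recurrence

  lookup-⊕ℕ : ∀ x y w → lookup (x ⊕ y) w ≡ lookup x w ℕ.+ lookup y w
  lookup-⊕ℕ x y w = lookup-zipWith ℕ._+_ w x y

  infix 21 _⊛_
  _⊛_ : ℕ → Config → Config
  m ⊛ x = tabulate λ w → m ℕ.* lookup x w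

  lookup-⊛ : ∀ m x w → lookup (m ⊛ x) w ≡ m ℕ.* lookup x w
  lookup-⊛ m x w = lookup∘tabulate _ w

  -- Every vertex exactly at its threshold; the configurations `δ ⊕ ζ` are those with all vertices
  -- unstable.
  δ : Config
  δ = tabulate (outdeg ∘ ι)

  lookup-δ : ∀ w → lookup δ w ≡ outdeg (ι w)
  lookup-δ w = lookup∘tabulate _ w

  private
    abstract
      2δ-stabilization : ∃[ s ] Stabilization (δ ⊕ δ) s
      2δ-stabilization = stabilize (δ ⊕ δ) invariant (<-wellFounded _)
        where
        2δ : ∀ w → lookup (δ ⊕ δ) w ≡ outdeg (ι w) ℕ.+ outdeg (ι w)
        2δ w = trans (lookup-⊕ℕ δ δ w) (cong (λ o → o ℕ.+ o) (lookup-δ w))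
        invariant : Invariant (lookup (δ ⊕ δ))
        invariant g v = trans (2δ (g ∗ v)) (trans (cong (λ o → o ℕ.+ o) (outdeg∘ι-invariant g v)) (sym (2δ v)))

    s₀ : Config
    s₀ = proj₁ 2δ-stabilization

    stable-s₀ : Stable s₀
    stable-s₀ = proj₁ (proj₂ 2δ-stabilization)

    2δ⟶*s₀ : (δ ⊕ δ) ⟶* s₀
    2δ⟶*s₀ = proj₁ (proj₂ (proj₂ (proj₂ 2δ-stabilization)))

    -- Stability puts `s₀` below `δ`, so the truncated subtraction is exact.
    t₀ : Config
    t₀ = tabulate λ w → lookup δ w ℕ.∸ lookup s₀ w

    s₀+t₀≡δ : ∀ w → lookup s₀ w ℕ.+ lookup t₀ w ≡ lookup δ w
    s₀+t₀≡δ w = trans (cong (lookup s₀ w ℕ.+_) (lookup∘tabulate _ w))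
      (ℕₚ.m+[n∸m]≡n (ℕₚ.≤-trans (ℕₚ.<⇒≤ (stable-s₀ w)) (ℕₚ.≤-reflexive (sym (lookup-δ w)))))

  -- 2δ − (2δ)°, arranged without subtraction as δ + (δ − (2δ)°): a positive configuration in the
  -- image of the Laplacian that recurrent configurations absorb.
  e : Config
  e = δ ⊕ t₀

  script : Fin ∣𝒪∣ → ℕ
  script = proj₁ (proj₂ (proj₂ (proj₂ (proj₂ 2δ-stabilization))))

  e-script : ∀ w → + lookup e w ≡ (Δ̃ᵀ *ᵥ ⟦ script ∘ cls ⟧) w
  e-script w = begin
    + lookup e w                                        ≡⟨ lookup-⊕ δ t₀ w ⟩
    + lookup δ w + + lookup t₀ w                        ≡⟨ add-subtract (+ lookup δ w) (+ lookup s₀ w) (+ lookup t₀ w) ⟩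
    + lookup δ w + + (lookup s₀ w ℕ.+ lookup t₀ w) + - + lookup s₀ w
      ≡⟨ cong (λ x → + lookup δ w + + x + - + lookup s₀ w) (s₀+t₀≡δ w) ⟩
    + lookup δ w + + lookup δ w + - + lookup s₀ w
      ≡⟨ cong₂ (λ x y → x + - y) (sym (lookup-⊕ δ δ w)) (proj₂ (proj₂ (proj₂ (proj₂ (proj₂ 2δ-stabilization)))) w) ⟩
    + lookup (δ ⊕ δ) w + - (+ lookup (δ ⊕ δ) w + - (Δ̃ᵀ *ᵥ ⟦ script ∘ cls ⟧) w)
      ≡⟨ cancel (+ lookup (δ ⊕ δ) w) ((Δ̃ᵀ *ᵥ ⟦ script ∘ cls ⟧) w) ⟩
    (Δ̃ᵀ *ᵥ ⟦ script ∘ cls ⟧) w                          ∎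
    where
    open ≡-Reasoning
    add-subtract : ∀ a b c → a + c ≡ a + (b + c) + - b
    add-subtract = solve-∀
    cancel : ∀ a b → a + - (a + - b) ≡ b
    cancel = solve-∀

  e-invariant : Invariant (lookup e)
  e-invariant g w = ℤₚ.+-injective (trans (e-script (g ∗ w))
    (trans (Δ̃ᵀ-invariant (∘cls-invariant λ j → + script j) g w) (sym (e-script w))))

  -- Outdegrees are positive because the stable `s₀` has entries below them, and `e` is at least
  -- `δ`.
  e-positive : ∀ w → 0 ℕ.< lookup e w
  e-positive w = begin-strict
    0                             ≤⟨ ℕ.z≤n ⟩
    lookup s₀ w                   <⟨ stable-s₀ w ⟩
    outdeg (ι w)                  ≡⟨ lookup-δ w ⟨
    lookup δ w                    ≤⟨ ℕₚ.m≤m+n _ _ ⟩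
    lookup δ w ℕ.+ lookup t₀ w    ≡⟨ lookup-⊕ℕ δ t₀ w ⟨
    lookup e w                    ∎
    where open ℕₚ.≤-Reasoning

  m≤m⊛e : ∀ m w → m ℕ.≤ lookup (m ⊛ e) w
  m≤m⊛e m w = ℕₚ.≤-trans (ℕₚ.m≤m*n m (lookup e w) {{ℕ.>-nonZero (e-positive w)}}) (ℕₚ.≤-reflexive (sym (lookup-⊛ m e w)))

  -- The left side is `δ ⊕ δ` with `ζ ⊕ t₀` added. The firings from `δ ⊕ δ` to `s₀` stay legal
  -- beside these grains, and `s₀` and `t₀` together make up `δ` again.
  absorb-once : ∀ ζ → ((δ ⊕ ζ) ⊕ e) ⟶* (δ ⊕ ζ)
  absorb-once ζ = subst (_⟶* (δ ⊕ ζ)) (lookup-ext left)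
    (subst (((δ ⊕ δ) ⊕ (ζ ⊕ t₀)) ⟶*_) (lookup-ext right) (⊕-mono-⟶* (ζ ⊕ t₀) 2δ⟶*s₀))
    where
    open ≡-Reasoning
    middle : ∀ a b c d → (a ℕ.+ b) ℕ.+ (c ℕ.+ d) ≡ (a ℕ.+ c) ℕ.+ (b ℕ.+ d)
    middle = ℕ-Solver.solve-∀
    regroup : ∀ a b c → a ℕ.+ (b ℕ.+ c) ≡ (a ℕ.+ c) ℕ.+ b
    regroup = ℕ-Solver.solve-∀
    expand : ∀ a b c d w → lookup ((a ⊕ b) ⊕ (c ⊕ d)) w ≡ (lookup a w ℕ.+ lookup b w) ℕ.+ (lookup c w ℕ.+ lookup d w)
    expand a b c d w = trans (lookup-⊕ℕ (a ⊕ b) (c ⊕ d) w) (cong₂ ℕ._+_ (lookup-⊕ℕ a b w) (lookup-⊕ℕ c d w))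
    left : ∀ w → lookup ((δ ⊕ δ) ⊕ (ζ ⊕ t₀)) w ≡ lookup ((δ ⊕ ζ) ⊕ e) w
    left w = trans (expand δ δ ζ t₀ w) (trans (middle (lookup δ w) (lookup δ w) (lookup ζ w) (lookup t₀ w)) (sym (expand δ ζ δ t₀ w)))
    right : ∀ w → lookup (s₀ ⊕ (ζ ⊕ t₀)) w ≡ lookup (δ ⊕ ζ) w
    right w = begin
      lookup (s₀ ⊕ (ζ ⊕ t₀)) w                               ≡⟨ trans (lookup-⊕ℕ s₀ (ζ ⊕ t₀) w) (cong (lookup s₀ w ℕ.+_) (lookup-⊕ℕ ζ t₀ w)) ⟩
      lookup s₀ w ℕ.+ (lookup ζ w ℕ.+ lookup t₀ w)           ≡⟨ regroup (lookup s₀ w) (lookup ζ w) (lookup t₀ w) ⟩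
      (lookup s₀ w ℕ.+ lookup t₀ w) ℕ.+ lookup ζ w           ≡⟨ cong (ℕ._+ lookup ζ w) (s₀+t₀≡δ w) ⟩
      lookup δ w ℕ.+ lookup ζ w                              ≡⟨ lookup-⊕ℕ δ ζ w ⟨
      lookup (δ ⊕ ζ) w                                       ∎

  -- Since `ζ` is arbitrary, the copies of `e` not yet fired away can be counted as part of it.
  absorb : ∀ m ζ → ((δ ⊕ ζ) ⊕ m ⊛ e) ⟶* (δ ⊕ ζ)
  absorb zero ζ = subst (_⟶* (δ ⊕ ζ)) (lookup-ext λ w → sym (trans (lookup-⊕ℕ (δ ⊕ ζ) (0 ⊛ e) w)
    (trans (cong (lookup (δ ⊕ ζ) w ℕ.+_) (lookup-⊛ 0 e w)) (ℕₚ.+-identityʳ _)))) ε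
  absorb (suc m) ζ = subst (_⟶* (δ ⊕ ζ)) (lookup-ext outer) (absorb-once (ζ ⊕ m ⊛ e) ◅◅
      subst (_⟶* (δ ⊕ ζ)) (lookup-ext inner) (absorb m ζ))
    where
    open ≡-Reasoning
    inner : ∀ w → lookup ((δ ⊕ ζ) ⊕ m ⊛ e) w ≡ lookup (δ ⊕ (ζ ⊕ m ⊛ e)) w
    inner w = begin
      lookup ((δ ⊕ ζ) ⊕ m ⊛ e) w                              ≡⟨ trans (lookup-⊕ℕ (δ ⊕ ζ) (m ⊛ e) w) (cong (ℕ._+ lookup (m ⊛ e) w) (lookup-⊕ℕ δ ζ w)) ⟩
      lookup δ w ℕ.+ lookup ζ w ℕ.+ lookup (m ⊛ e) w          ≡⟨ ℕₚ.+-assoc (lookup δ w) (lookup ζ w) (lookup (m ⊛ e) w) ⟩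
      lookup δ w ℕ.+ (lookup ζ w ℕ.+ lookup (m ⊛ e) w)        ≡⟨ trans (lookup-⊕ℕ δ (ζ ⊕ m ⊛ e) w) (cong (lookup δ w ℕ.+_) (lookup-⊕ℕ ζ (m ⊛ e) w)) ⟨
      lookup (δ ⊕ (ζ ⊕ m ⊛ e)) w                              ∎
    regroup : ∀ a b c → a ℕ.+ b ℕ.+ c ≡ a ℕ.+ (c ℕ.+ b)
    regroup = ℕ-Solver.solve-∀
    outer : ∀ w → lookup ((δ ⊕ (ζ ⊕ m ⊛ e)) ⊕ e) w ≡ lookup ((δ ⊕ ζ) ⊕ suc m ⊛ e) w
    outer w = begin
      lookup ((δ ⊕ (ζ ⊕ m ⊛ e)) ⊕ e) w
        ≡⟨ trans (lookup-⊕ℕ (δ ⊕ (ζ ⊕ m ⊛ e)) e w) (cong (ℕ._+ lookup e w) (sym (inner w))) ⟩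
      lookup ((δ ⊕ ζ) ⊕ m ⊛ e) w ℕ.+ lookup e w
        ≡⟨ cong (ℕ._+ lookup e w) (trans (lookup-⊕ℕ (δ ⊕ ζ) (m ⊛ e) w) (cong (lookup (δ ⊕ ζ) w ℕ.+_) (lookup-⊛ m e w))) ⟩
      lookup (δ ⊕ ζ) w ℕ.+ m ℕ.* lookup e w ℕ.+ lookup e w
        ≡⟨ regroup (lookup (δ ⊕ ζ) w) (m ℕ.* lookup e w) (lookup e w) ⟩
      lookup (δ ⊕ ζ) w ℕ.+ suc m ℕ.* lookup e w
        ≡⟨ trans (lookup-⊕ℕ (δ ⊕ ζ) (suc m ⊛ e) w) (cong (lookup (δ ⊕ ζ) w ℕ.+_) (lookup-⊛ (suc m) e w)) ⟨
      lookup ((δ ⊕ ζ) ⊕ suc m ⊛ e) w ∎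

  -- Enough copies of `e` cover any given `a`; `b` is what is left of the total. The copies are then
  -- absorbed, and the path to `x` continues from `δ ⊕ ζ`.
  reached⇒recurrent : ∀ {ζ x} → Stable x → (δ ⊕ ζ) ⟶* x → Recurrent x
  reached⇒recurrent {ζ} {x} stable path = stable , λ a →
    let m = ℕΣ.sum (lookup a)
        total = (δ ⊕ ζ) ⊕ m ⊛ e
        b = tabulate λ w → lookup total w ℕ.∸ lookup a w
        a≤total : ∀ w → lookup a w ℕ.≤ lookup total w
        a≤total w = ℕₚ.≤-trans (term≤sum (lookup a) w) (ℕₚ.≤-trans (m≤m⊛e m w)
          (ℕₚ.≤-trans (ℕₚ.m≤n+m _ (lookup (δ ⊕ ζ) w)) (ℕₚ.≤-reflexive (sym (lookup-⊕ℕ (δ ⊕ ζ) (m ⊛ e) w)))))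
        total≡a⊕b : total ≡ a ⊕ b
        total≡a⊕b = lookup-ext λ w → sym (trans (lookup-⊕ℕ a b w)
          (trans (cong (lookup a w ℕ.+_) (lookup∘tabulate _ w)) (ℕₚ.m+[n∸m]≡n (a≤total w))))
    in b , subst (_⟶* x) total≡a⊕b (absorb m ζ ◅◅ path) , stable

  -- Recurrence supplies `b` with a path from `δ ⊕ b` to `x`. With `m ⊛ e` added, that start reaches
  -- `x` by absorbing first and `x ⊕ m ⊛ e` by following the path, so confluence joins the two.
  recurrent-absorbs : ∀ {x} → Recurrent x → ∀ m → (x ⊕ m ⊛ e) ⟶* x
  recurrent-absorbs (stable , reach) m =
    let b , path , _ = reach δ
    in confluence stable (absorb m b ◅◅ path) (⊕-mono-⟶* (m ⊛ e) path)

  pos neg : ℤ → ℕ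
  pos (+ m)      = m
  pos (ℤ.-[1+ m ]) = 0
  neg (+ m)      = 0
  neg (ℤ.-[1+ m ]) = suc m

  pos-neg : ∀ i → i ≡ + pos i + - + neg i
  pos-neg (+ m)        = sym (ℤₚ.+-identityʳ (+ m))
  pos-neg (ℤ.-[1+ m ]) = refl

  -- With enough multiples of e added, the positive and negative parts of σ can be fired legally
  -- from x and y respectively, which leads to a common configuration.
  recurrent-unique : ∀ {x y} → Recurrent x → Recurrent y →
    (σ : Fin n → ℤ) → (∀ w → + lookup x w ≡ + lookup y w + (Δ̃ᵀ *ᵥ σ) w) → x ≡ y
  recurrent-unique {x} {y} x-rec y-rec σ eq =
    stable-unique {proj₁ fire-x} (proj₁ x-rec) (proj₁ y-rec)
      (confluence (proj₁ x-rec) (recurrent-absorbs x-rec m) (proj₁ (proj₂ fire-x)))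
      (confluence (proj₁ y-rec) (recurrent-absorbs y-rec m) (subst ((y ⊕ m ⊛ e) ⟶*_) (sym common) (proj₁ (proj₂ fire-y))))
    where
    open ≡-Reasoning
    need : (Fin n → ℕ) → ℕ
    need ρ = ℕΣ.sum λ w → ρ w ℕ.* outdeg (ι w)
    m = need (pos ∘ σ) ℕ.+ need (neg ∘ σ)
    enough : ∀ z ρ → need ρ ℕ.≤ m → ∀ w → ρ w ℕ.* outdeg (ι w) ℕ.≤ lookup (z ⊕ m ⊛ e) w
    enough z ρ need≤m w = ℕₚ.≤-trans (term≤sum (λ w → ρ w ℕ.* outdeg (ι w)) w) (ℕₚ.≤-trans need≤m (ℕₚ.≤-trans (m≤m⊛e m w)
      (ℕₚ.≤-trans (ℕₚ.m≤n+m _ (lookup z w)) (ℕₚ.≤-reflexive (sym (lookup-⊕ℕ z (m ⊛ e) w))))))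
    fire-x = fireScript (ℕΣ.sum (pos ∘ σ)) (pos ∘ σ) refl (x ⊕ m ⊛ e) (enough x (pos ∘ σ) (ℕₚ.m≤m+n (need (pos ∘ σ)) (need (neg ∘ σ))))
    fire-y = fireScript (ℕΣ.sum (neg ∘ σ)) (neg ∘ σ) refl (y ⊕ m ⊛ e) (enough y (neg ∘ σ) (ℕₚ.m≤n+m (need (neg ∘ σ)) (need (pos ∘ σ))))
    split : ∀ w → (Δ̃ᵀ *ᵥ σ) w ≡ 1ℤ * (Δ̃ᵀ *ᵥ ⟦ pos ∘ σ ⟧) w + -1ℤ * (Δ̃ᵀ *ᵥ ⟦ neg ∘ σ ⟧) w
    split w = trans (*ᵥ-cong Δ̃ᵀ (λ u → trans (pos-neg (σ u)) (signs (+ pos (σ u)) (+ neg (σ u)))) w)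
      (*ᵥ-linear Δ̃ᵀ 1ℤ -1ℤ ⟦ pos ∘ σ ⟧ ⟦ neg ∘ σ ⟧ w)
      where
      signs : ∀ p q → p + - q ≡ 1ℤ * p + -1ℤ * q
      signs = solve-∀
    common : proj₁ fire-x ≡ proj₁ fire-y
    common = lookup-ext λ w → ℤₚ.+-injective (begin
      + lookup (proj₁ fire-x) w
        ≡⟨ trans (proj₁ (proj₂ (proj₂ fire-x)) w) (cong (_+ - P w) (trans (lookup-⊕ x (m ⊛ e) w) (cong (_+ E w) (trans (eq w) (cong (_+_ (+ lookup y w)) (split w)))))) ⟩
      ((+ lookup y w + (1ℤ * P w + -1ℤ * N w)) + E w) + - P w
        ≡⟨ rearrange (+ lookup y w) (P w) (N w) (E w) ⟩
      (+ lookup y w + E w) + - N w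
        ≡⟨ trans (proj₁ (proj₂ (proj₂ fire-y)) w) (cong (_+ - N w) (lookup-⊕ y (m ⊛ e) w)) ⟨
      + lookup (proj₁ fire-y) w ∎)
      where
      P N E : Fin n → ℤ
      P = Δ̃ᵀ *ᵥ ⟦ pos ∘ σ ⟧
      N = Δ̃ᵀ *ᵥ ⟦ neg ∘ σ ⟧
      E w = + lookup (m ⊛ e) w
      rearrange : ∀ y p q e → ((y + (1ℤ * p + -1ℤ * q)) + e) + - p ≡ (y + e) + - q
      rearrange = solve-∀

  -- Symmetric recurrent configurations and the cokernel

  onOrbits : Config → Fin ∣𝒪∣ → ℤ
  onOrbits x i = + lookup x (rep i)

  -- Invariance spreads the congruence from the representatives to all vertices, with the
  -- coefficient of each orbit repeated on its members, so that uniqueness for general scripts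
  -- applies.
  symmetricRecurrent-unique : ∀ {x y} → Recurrent x → Recurrent y → Invariant (lookup x) → Invariant (lookup y) →
    onOrbits x ≈ onOrbits y mod Δ̃ᴳ → x ≡ y
  symmetricRecurrent-unique {x} {y} x-rec y-rec x-inv y-inv (z by eq) = recurrent-unique x-rec y-rec (z ∘ cls) λ w → begin
    + lookup x w                                               ≡⟨ cong +_ (invariant-orbit x-inv (∈-cls w)) ⟩
    + lookup x (rep (cls w))                                   ≡⟨ eq (cls w) ⟩
    + lookup y (rep (cls w)) + (Δ̃ᴳ *ᵥ z) (cls w)               ≡⟨ cong (_+_ (+ lookup y (rep (cls w)))) (Δ̃ᴳ-*ᵥ z (cls w)) ⟩
    + lookup y (rep (cls w)) + (Δ̃ᵀ *ᵥ (z ∘ cls)) (rep (cls w))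
      ≡⟨ cong₂ (λ a b → + a + b) (invariant-orbit y-inv (∈-cls w)) (invariant-orbit (Δ̃ᵀ-invariant (∘cls-invariant z)) (∈-cls w)) ⟨
    + lookup y w + (Δ̃ᵀ *ᵥ (z ∘ cls)) w                         ∎
    where open ≡-Reasoning

  -- Adding `m` copies of `e` and then stabilizing both stay within the class, with coefficients `m`
  -- times `script` and `- τ`.
  represent : ∀ z → ∃[ x ] Recurrent x × Invariant (lookup x) × onOrbits x ≈ z mod Δ̃ᴳ
  represent z = s , reached⇒recurrent stable X⟶*s , invariant , ((λ j → + m * + script j + -1ℤ * + τ j) by λ i → begin
      + lookup s (rep i)
        ≡⟨ eq (rep i) ⟩
      + lookup X (rep i) + - (Δ̃ᵀ *ᵥ ⟦ τ ∘ cls ⟧) (rep i)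
        ≡⟨ cong₂ (λ a b → a + - b) (lookup-X (rep i)) (sym (Δ̃ᴳ-*ᵥ (λ j → + τ j) i)) ⟩
      (z (cls (rep i)) + + m * + lookup e (rep i)) + - (Δ̃ᴳ *ᵥ (λ j → + τ j)) i
        ≡⟨ cong₂ (λ a b → (z a + + m * b) + - (Δ̃ᴳ *ᵥ (λ j → + τ j)) i) (cls-rep i) (trans (e-script (rep i)) (sym (Δ̃ᴳ-*ᵥ (λ j → + script j) i))) ⟩
      (z i + + m * (Δ̃ᴳ *ᵥ (λ j → + script j)) i) + - (Δ̃ᴳ *ᵥ (λ j → + τ j)) i
        ≡⟨ rearrange (z i) (+ m * (Δ̃ᴳ *ᵥ (λ j → + script j)) i) ((Δ̃ᴳ *ᵥ (λ j → + τ j)) i) ⟩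
      z i + (+ m * (Δ̃ᴳ *ᵥ (λ j → + script j)) i + -1ℤ * (Δ̃ᴳ *ᵥ (λ j → + τ j)) i)
        ≡⟨ cong (_+_ (z i)) (*ᵥ-linear Δ̃ᴳ (+ m) -1ℤ (λ j → + script j) (λ j → + τ j) i) ⟨
      z i + (Δ̃ᴳ *ᵥ (λ j → + m * + script j + -1ℤ * + τ j)) i ∎)
    where
    open ≡-Reasoning
    rearrange : ∀ a b c → (a + b) + - c ≡ a + (b + -1ℤ * c)
    rearrange = solve-∀
    -- The first sum outweighs every negative entry of `z`; the second leaves room for `δ`. Entries
    -- of `e` are at least 1, so `m` copies suffice for both.
    m = ℕΣ.sum (∣_∣ ∘ z) ℕ.+ ℕΣ.sum (lookup δ)
    -- Splitting `δ` off gives `X` the shape `δ ⊕ ζ` that ensures recurrence of the result; the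
    -- excess is nonnegative, so the absolute values in `ζ` lose nothing.
    excess : Fin n → ℤ
    excess w = z (cls w) + + m * + lookup e w + - + lookup δ w
    excess≥0 : ∀ w → 0ℤ ℤ.≤ excess w
    excess≥0 w = subst (0ℤ ℤ.≤_) (regroup (z (cls w)) (+ ∣ z (cls w) ∣) (+ m * + lookup e w) (+ lookup δ w))
      (ℤₚ.+-mono-≤ {0ℤ} {_} {0ℤ} (abs-bound (z (cls w))) (ℤₚ.i≤j⇒0≤j-i large))
      where
      regroup : ∀ a b c d → (a + b) + (c + - (b + d)) ≡ a + c + - d
      regroup = solve-∀
      abs-bound : ∀ i → 0ℤ ℤ.≤ i + + ∣ i ∣
      abs-bound (+ a)        = ℤ.+≤+ ℕ.z≤n
      abs-bound (ℤ.-[1+ a ]) = ℤₚ.≤-reflexive (sym (ℤₚ.n⊖n≡0 (suc a)))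
      large : + ∣ z (cls w) ∣ + + lookup δ w ℤ.≤ + m * + lookup e w
      large = subst (+ ∣ z (cls w) ∣ + + lookup δ w ℤ.≤_) (ℤₚ.pos-* m (lookup e w))
        (ℤ.+≤+ (ℕₚ.≤-trans (ℕₚ.+-mono-≤ (term≤sum (∣_∣ ∘ z) (cls w)) (term≤sum (lookup δ) w))
          (ℕₚ.m≤m*n m (lookup e w) {{ℕ.>-nonZero (e-positive w)}})))
    ζ X : Config
    ζ = tabulate (∣_∣ ∘ excess)
    X = δ ⊕ ζ
    lookup-X : ∀ w → + lookup X w ≡ z (cls w) + + m * + lookup e w
    lookup-X w = trans (lookup-⊕ δ ζ w) (trans
      (cong (λ a → + lookup δ w + a) (trans (cong +_ (lookup∘tabulate _ w)) (ℤₚ.0≤i⇒+∣i∣≡i (excess≥0 w))))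
      (cancel (+ lookup δ w) (z (cls w) + + m * + lookup e w)))
      where
      cancel : ∀ a b → a + (b + - a) ≡ b
      cancel = solve-∀
    X-invariant : Invariant (lookup X)
    X-invariant g w = ℤₚ.+-injective (trans (lookup-X (g ∗ w)) (trans
      (cong₂ (λ a b → z a + + m * + b) (cls-invariant g w) (e-invariant g w)) (sym (lookup-X w))))
    result = stabilize X X-invariant (<-wellFounded _)
    s = proj₁ result
    stable = proj₁ (proj₂ result)
    invariant = proj₁ (proj₂ (proj₂ result))
    X⟶*s = proj₁ (proj₂ (proj₂ (proj₂ result)))
    τ = proj₁ (proj₂ (proj₂ (proj₂ (proj₂ result))))
    eq = proj₂ (proj₂ (proj₂ (proj₂ (proj₂ result))))

  -- Uniqueness serves twice: congruent vectors get the same representative, and the representative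
  -- of the class of a symmetric recurrent configuration is that configuration.
  symmetricRecurrent↔cokernel : Inverse SymmetricRecurrent (Cokernel Δ̃ᴳ)
  symmetricRecurrent↔cokernel = mkInverse {S = SymmetricRecurrent} {T = Cokernel Δ̃ᴳ}
    (onOrbits ∘ proj₁)
    (λ z → let x , x-rec , x-inv , _ = represent z in x , x-rec , invariant⇒symmetric x-inv)
    (λ { refl → ≈-reflexive λ _ → refl })
    (λ {z} {z′} z≈z′ →
      let _ , x-rec , x-inv , x≈z = represent z
          _ , y-rec , y-inv , y≈z′ = represent z′
      in symmetricRecurrent-unique x-rec y-rec x-inv y-inv (≈-trans x≈z (≈-trans z≈z′ (≈-sym y≈z′))))
    (λ z → proj₂ (proj₂ (proj₂ (represent z))))
    (λ (x , x-rec , x-sym) →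
      let _ , y-rec , y-inv , y≈x = represent (onOrbits x)
      in symmetricRecurrent-unique y-rec x-rec y-inv (symmetric⇒invariant x-sym) y≈x)

  det-Δ̃ᴳ-positive : 0ℤ ℤ.< det Δ̃ᴳ
  det-Δ̃ᴳ-positive = det-positive Δ̃ᴳ (λ j → + script j) off-diagonal (λ _ → ℤ.+≤+ ℕ.z≤n)
    (λ i → subst (0ℤ ℤ.<_) (trans (e-script (rep i)) (sym (Δ̃ᴳ-*ᵥ (λ j → + script j) i))) (ℤ.+<+ (e-positive (rep i))))
    where
    -- A vertex in the orbit of `rep j` differs from `rep i`, so no outdegree enters the entry, only
    -- negated weights.
    off-diagonal : ∀ {i j} → i ≢ j → Δ̃ᴳ i j ℤ.≤ 0ℤ
    off-diagonal {i} {j} i≢j = sum-nonpos λ u → entry u (u ∈Orbit? rep j)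
      where
      entry : ∀ u (d : Dec (u ∈Orbit rep j)) → (if does d then Δ̃ u (rep i) else 0ℤ) ℤ.≤ 0ℤ
      entry u (no _)    = ℤₚ.≤-refl
      entry u (yes u∈j) = subst (ℤ._≤ 0ℤ) (sym (Δ̃-off-diagonal u≢rep)) ℤₚ.neg-≤-pos
        where
        u≢rep : u ≢ rep i
        u≢rep u≡rep = i≢j (rep-injective (subst (_∈Orbit rep j) u≡rep u∈j))

corollary2p11 : ∀ {c ℓ : Level} {k n : ℕ} (G : Group c ℓ) (finite : HasCardinality (Group.setoid G) k)
    (Γ : SandpileGraph n) (A : Action G Γ) →
    let open Symmetric finite A in
    ∃[ N ] (HasCardinality SymmetricRecurrent N × + N ≡ det Δ̃ᴳ)
-- Positivity of the determinant acts twice: it makes the cokernel finite, and it removes the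
-- absolute value from the count.
corollary2p11 G finite Γ A = ∣ det Δ̃ᴳ ∣
  , Compose.inverse symmetricRecurrent↔cokernel (cokernel-cardinality Δ̃ᴳ λ det≡0 → ℤₚ.<-irrefl (sym det≡0) det-Δ̃ᴳ-positive)
  , ℤₚ.0≤i⇒+∣i∣≡i (ℤₚ.<⇒≤ det-Δ̃ᴳ-positive)
  where
  open Symmetric finite A
  open SymmetricSandpile finite A
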